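{- For every integer $k\ge 0$ and every real $r\ge 0$, there exist $L,C\ge 1$ such that the following holds. If a graph $G$ admits a line-decomposition $(\Lambda,(B_t:t\in \Lambda))$ such that for each $t\in \Lambda$, $B_t$ is the union of at most $k$ sets each with diameter at most $r$ in $G$, then $G$ admits an $(L,C)$-quasi-isometry to a graph with line-width at most $k$.
   Context: Graphs may be infinite, and need not be connected. $\dist_G(u,v)$ is the number of edges in a shortest path of $G$ between $u,v$ ($\infty$ if there is none). The diameter of $X\subseteq V(G)$ in $G$ is the maximum of $\dist_G(u,v)$ over all $u,v\in X$ (distances are measured in $G$, not in $G[X]$). For $L,C\ge 0$, a map $\phi:V(G)\to V(H)$ is an $(L,C)$-quasi-isometry from $G$ to $H$ if: (i) for all $u,v\in V(G)$, if $\dist_G(u,v)$ is finite then $\dist_H(\phi(u),\phi(v))\le L\dist_G(u,v)+C$; (ii) for all $u,v\in V(G)$, if $\dist_H(\phi(u),\phi(v))$ is finite then $\dist_G(u,v)\le L\dist_H(\phi(u),\phi(v))+C$; (iii) for every $y\in V(H)$ there exists $v\in V(G)$ with $\dist_H(\phi(v),y)\le C$. "$G$ admits an $(L,C)$-quasi-isometry to $H$" means such a $\phi$ exists. A line is a set $\Lambda$ linearly ordered by a relation $\le_\Lambda$. A line-decomposition of $G$ is a pair $(\Lambda,(B_t:t\in \Lambda))$ where $\Lambda$ is a line and each $B_t\subseteq V(G)$, such that $G=\bigcup_{t\in \Lambda}G[B_t]$, and $B_t\cap B_{t''}\subseteq B_{t'}$ for all $t,t',t''\in \Lambda$ with $t\le_\Lambda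 t'\le_\Lambda t''$. Its width is the maximum of $|B_t|-1$ over $t\in \Lambda$ if this maximum exists, and $\infty$ otherwise; the line-width of $G$ is the minimum width of a line-decomposition of $G$. -}

module Defs where

open import Level using (Level; suc; 0ℓ)
open import Data.Nat as ℕ using (ℕ)
open import Data.Integer using (+_)
open import Data.Rational as ℚ using (ℚ)
import Data.Rational.Properties as ℚ
open import Data.Fin using (Fin)
open import Data.List using (List; []; _∷_; length)
import Data.List.Membership.Propositional as List
open import Data.List.Relation.Unary.Unique.Propositional using (Unique)
open import Data.Product using (∃; ∃-syntax; _×_; _,_)
open import Function.Bundles using (_⇔_)
open import Relation.Binary.Structures using (IsTotalOrder)
open import Relation.Binary.PropositionalEquality using (_≡_; refl; sym; cong; trans; subst)
open import Relation.Nullary using (¬_)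
open import Relation.Unary using (Pred; _∈_)

private variable
  ℓ : Level

-- Real numbers as Dedekind cuts, each given by its lower set of rationals.
-- One-sided cuts are the textbook classical construction; constructively
-- they would only be the lower reals, but they are used here only in the
-- presence of excluded middle.
record ℝ : Set₁ where
  field
    lower     : Pred ℚ 0ℓ
    inhabited : ∃[ q ] q ∈ lower
    bounded   : ∃[ u ] (∀ {q} → q ∈ lower → q ℚ.< u)
    closed    : ∀ {p q} → p ℚ.< q → q ∈ lower → p ∈ lower
    rounded   : ∀ {p} → p ∈ lower → ∃[ q ] (p ℚ.< q × q ∈ lower)

open ℝ public using (lower)

infix  4 _≤ʳ_
infixl 6 _+ʳ_
infixl 7 _·ʳ_

_≤ʳ_ : ℝ → ℝ → Set
x ≤ʳ y = ∀ {q} → q ∈ lower x → q ∈ lower y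

fromℕ : ℕ → ℝ
fromℕ n = record
  { lower     = λ q → q ℚ.< n/1
  ; inhabited = n/1 ℚ.- ℚ.1ℚ
              , subst (n/1 ℚ.- ℚ.1ℚ ℚ.<_) (ℚ.+-identityʳ n/1)
                  (ℚ.+-monoʳ-< n/1 (ℚ.negative⁻¹ (ℚ.- ℚ.1ℚ)))
  ; bounded   = n/1 , λ q<n → q<n
  ; closed    = ℚ.<-trans
  ; rounded   = ℚ.<-dense
  }
  where
  n/1 : ℚ
  n/1 = + n ℚ./ 1

_+ʳ_ : ℝ → ℝ → ℝ
x +ʳ y = record
  { lower     = λ q → ∃[ a ] ∃[ b ] (a ∈ lower x × b ∈ lower y × q ≡ a ℚ.+ b)
  ; inhabited = let (a , a∈x) = X.inhabited
                    (b , b∈y) = Y.inhabited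
                in a ℚ.+ b , a , b , a∈x , b∈y , refl
  ; bounded   = let (u , x<u) = X.bounded
                    (v , y<v) = Y.bounded
                in u ℚ.+ v , λ { (a , b , a∈x , b∈y , refl) → ℚ.+-mono-< (x<u a∈x) (y<v b∈y) }
  ; closed    = λ { {p} p<a+b (a , b , a∈x , b∈y , refl) →
                    p ℚ.- b , b
                  , X.closed (subst (p ℚ.- b ℚ.<_) (+-cancel a b) (ℚ.+-monoˡ-< (ℚ.- b) p<a+b)) a∈x
                  , b∈y , sym (-+-cancel p b) }
  ; rounded   = λ { (a , b , a∈x , b∈y , refl) →
                    let (a′ , a<a′ , a′∈x) = X.rounded a∈x
                    in a′ ℚ.+ b , ℚ.+-monoˡ-< b a<a′ , a′ , b , a′∈x , b∈y , refl }
  }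
  where
  module X = ℝ x
  module Y = ℝ y

  +-cancel : ∀ a b → a ℚ.+ b ℚ.- b ≡ a
  +-cancel a b = trans (ℚ.+-assoc a b (ℚ.- b))
                   (trans (cong (a ℚ.+_) (ℚ.+-inverseʳ b)) (ℚ.+-identityʳ a))

  -+-cancel : ∀ a b → a ℚ.- b ℚ.+ b ≡ a
  -+-cancel a b = trans (ℚ.+-assoc a (ℚ.- b) b)
                    (trans (cong (a ℚ.+_) (ℚ.+-inverseˡ b)) (ℚ.+-identityʳ a))

-- Distances are natural numbers, so this is the only product a
-- quasi-isometry inequality L · dist + C involves.
_·ʳ_ : ℝ → ℕ → ℝ
x ·ʳ ℕ.zero  = fromℕ 0
x ·ʳ ℕ.suc n = x ·ʳ n +ʳ x

record Graph (ℓ : Level) : Set (suc ℓ) where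
  field
    V      : Set ℓ
    Adj    : V → V → Set ℓ
    symm   : ∀ {u v} → Adj u v → Adj v u
    irrefl : ∀ {v} → ¬ Adj v v

open Graph public using (V)

module _ (G : Graph ℓ) where
  open Graph G using (Adj)

  data Walk : V G → V G → Set ℓ where
    nil  : ∀ {v} → Walk v v
    cons : ∀ {u v w} → Adj u v → Walk v w → Walk u w

  edges : ∀ {u v} → Walk u v → ℕ
  edges nil        = 0
  edges (cons _ p) = ℕ.suc (edges p)

  vertices : ∀ {u v} → Walk u v → List (V G)
  vertices {u} nil        = u ∷ []
  vertices {u} (cons _ p) = u ∷ vertices p

  IsPath : ∀ {u v} → Walk u v → Set ℓ
  IsPath p = Unique (vertices p)

  -- The distance of u and v is finite and equal to d.
  IsDist : V G → V G → ℕ → Set ℓ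
  IsDist u v d =
    (∃[ p ] (IsPath {u} {v} p × edges p ≡ d)) ×
    (∀ p → IsPath {u} {v} p → d ℕ.≤ edges p)

  DistAtMost : V G → V G → ℝ → Set ℓ
  DistAtMost u v x = ∃[ d ] (IsDist u v d × fromℕ d ≤ʳ x)

  -- Distances are taken in G, not in the subgraph induced on X.
  DiamAtMost : Pred (V G) ℓ → ℝ → Set ℓ
  DiamAtMost X x = ∀ {u v} → u ∈ X → v ∈ X → DistAtMost u v x

  UnionOfAtMost : ℕ → ℝ → Pred (V G) ℓ → Set (suc ℓ)
  UnionOfAtMost k r B =
    ∃[ j ] (j ℕ.≤ k × ∃ λ (X : Fin j → Pred (V G) ℓ) →
      (∀ v → v ∈ B ⇔ (∃[ i ] v ∈ X i)) × (∀ i → DiamAtMost (X i) r))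

record IsQuasiIsometry (L C : ℝ) (G H : Graph ℓ) (φ : V G → V H) : Set ℓ where
  field
    upper : ∀ u v d → IsDist G u v d →
            DistAtMost H (φ u) (φ v) (L ·ʳ d +ʳ C)
    lower : ∀ u v d → IsDist H (φ u) (φ v) d →
            DistAtMost G u v (L ·ʳ d +ʳ C)
    dense : ∀ y → ∃[ v ] DistAtMost H (φ v) y C

AdmitsQuasiIsometry : ℝ → ℝ → Graph ℓ → Graph ℓ → Set ℓ
AdmitsQuasiIsometry L C G H = ∃[ φ ] IsQuasiIsometry L C G H φ

record Line (ℓ : Level) : Set (suc ℓ) where
  field
    Point        : Set ℓ
    _≤_          : Point → Point → Set ℓ
    isTotalOrder : IsTotalOrder _≡_ _≤_

record LineDecomposition (G : Graph ℓ) : Set (suc ℓ) where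
  field
    line : Line ℓ
  open Line line public
  field
    bag           : Point → Pred (V G) ℓ
    coversVertex  : ∀ v → ∃[ t ] v ∈ bag t
    coversEdge    : ∀ {u v} → Graph.Adj G u v → ∃[ t ] (u ∈ bag t × v ∈ bag t)
    interpolation : ∀ {t t′ t″} → t ≤ t′ → t′ ≤ t″ →
                    ∀ {v} → v ∈ bag t → v ∈ bag t″ → v ∈ bag t′

open LineDecomposition public using (Point; bag)

HasCardinality : {A : Set ℓ} → Pred A ℓ → ℕ → Set ℓ
HasCardinality B n =
  ∃[ xs ] (Unique xs × length xs ≡ n × (∀ v → v ∈ B ⇔ v List.∈ xs))

-- |B_t| - 1 ≤ k for all t. A decomposition over the empty line satisfies
-- this vacuously, but only the null graph has one, and that graph also has
-- a decomposition over a one-point line with an empty bag.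
WidthAtMost : {G : Graph ℓ} → LineDecomposition G → ℕ → Set ℓ
WidthAtMost D k = ∀ t → ∃[ n ] (HasCardinality (bag D t) n × n ℕ.≤ ℕ.suc k)

LineWidthAtMost : Graph ℓ → ℕ → Set (suc ℓ)
LineWidthAtMost G k = ∃ λ (D : LineDecomposition G) → WidthAtMost D k

{-# OPTIONS --safe #-}

-- Sweep the line from left to right and keep a head x(t), a vertex of the current bag, for as
-- long as it is alive. A vertex is captured once it is within R of the head, and stays captured.
-- When the head dies, the next one is, among the captured vertices still alive, one that lives
-- longest; hence a captured vertex stays near the heads and dies during the next period at the
-- latest. Since a whole piece of each bag is captured, the uncaptured vertices have bags covered
-- by k - 1 pieces, and iterating gives k levels of periods. This works on finite lines;
-- arbitrary lines follow by compactness, as all properties of the levels and periods are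
-- finitary. The vertices of H are the periods. A bag of H has one period for each level, plus one
-- more where a period is replaced by the next: k + 1 in total.
module Submission where

open import Defs
open import Level using (Level; 0ℓ; _⊔_) renaming (suc to lsuc)
open import Data.Nat using (ℕ)
open import Data.Product using (∃; _×_)
open import Axiom.ExcludedMiddle using (ExcludedMiddle)
open import Axiom.Extensionality.Propositional using (Extensionality)
open import Data.Bool using (Bool; true; false; T)
open import Data.Empty using (⊥)
open import Data.Fin using (Fin; toℕ; fromℕ<; punchOut; inject≤)
open import Data.Fin.Properties using (punchOut-injective; toℕ-injective; toℕ<n; toℕ-fromℕ<; inject≤-injective)
open import Data.Integer as ℤ using (+_; -[1+_])
import Data.Integer.Properties as ℤ
open import Data.List using (List; []; _∷_; _++_; length; lookup)
open import Data.List.Membership.Propositional using (_∈_)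
open import Data.List.Relation.Binary.Permutation.Propositional using (↭-sym)
open import Data.List.Relation.Binary.Permutation.Propositional.Properties using (∈-resp-↭)
open import Data.List.Relation.Binary.Subset.Propositional using (_⊆_)
open import Data.List.Relation.Binary.Subset.Propositional.Properties using (xs⊆xs++ys; xs⊆ys++xs)
open import Data.List.Relation.Unary.All as All using (All; []; _∷_)
open import Data.List.Relation.Unary.All.Properties using (¬Any⇒All¬; ++⁺; ++⁻ˡ; ++⁻ʳ)
open import Data.List.Relation.Unary.AllPairs using ([]; _∷_)
open import Data.List.Relation.Unary.Any using (here; there; index)
open import Data.List.Relation.Unary.Any.Properties using (lookup-index)
open import Data.List.Relation.Unary.Sorted.TotalOrder.Properties using (lookup-mono-≤)
import Data.List.Sort as Sort
open import Data.Nat as ℕ using (zero; suc; _+_; _*_; _^_; _≤_; _<_; z≤n; s≤s)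
import Data.Nat.Properties as ℕ
open import Data.Product using (∃-syntax; _,_; proj₁; proj₂)
open import Data.Rational as ℚ using (ℚ; toℚᵘ)
import Data.Rational.Properties as ℚ
open import Data.Rational.Unnormalised as ℚᵘ using (mkℚᵘ; *≡*; *≤*; *<*)
import Data.Rational.Unnormalised.Properties as ℚᵘ
open import Data.Sum using (_⊎_; inj₁; inj₂; [_,_]′)
open import Data.Unit using (⊤; tt)
open import Function using (id)
open import Function.Bundles using (Equivalence; mk⇔)
open import Relation.Binary.Bundles using (DecTotalOrder)
open import Relation.Binary.PropositionalEquality
open import Relation.Binary.Structures using (IsTotalOrder)
open import Relation.Nullary using (¬_; Dec; yes; no; contradiction; recompute)
open import Relation.Nullary.Decidable using (⌊_⌋; toWitness; fromWitness)
open import Relation.Unary using (Pred)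

-- The diameter of a period and the number of periods that one vertex meets must be bounded
-- independently of the length of the line. The danger is that distances add up from head to head.
-- They do not: the captured vertices that survive a head are within `R` of it, and its successor is
-- chosen among them if there are any. On an infinite line there may be no longest-lived vertex, so
-- the sweep cannot be run there directly. In the limit the heads need not converge; what survives
-- is the level of a vertex, which has at most `k` values, and the relation of lying in one period.
-- Hence `Layering` mentions no heads, and each of its laws involves at most three times. Periods of
-- the limit need not have a first or last time, so the line of `H` is built from cuts. The level of
-- a vertex never rises with time, and this decides the order in which the levels change at a common
-- cut.

private
  variable
    a b ℓ : Level

-- Real numbers

toℚᵘ-n/1 : ∀ n → toℚᵘ (+ n ℚ./ 1) ℚᵘ.≃ mkℚᵘ (+ n) 0
toℚᵘ-n/1 n = ℚ.toℚᵘ-fromℚᵘ (mkℚᵘ (+ n) 0)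

n/1-mono-≤ : ∀ {m n} → m ≤ n → + m ℚ./ 1 ℚ.≤ + n ℚ./ 1
n/1-mono-≤ {m} {n} m≤n = ℚ.toℚᵘ-cancel-≤
  (ℚᵘ.≤-respˡ-≃ (ℚᵘ.≃-sym (toℚᵘ-n/1 m)) (ℚᵘ.≤-respʳ-≃ (ℚᵘ.≃-sym (toℚᵘ-n/1 n))
    (*≤* (ℤ.*-monoʳ-≤-nonNeg (+ 1) (ℤ.+≤+ m≤n)))))

n/1-homo-+ : ∀ m n → + (m + n) ℚ./ 1 ≡ + m ℚ./ 1 ℚ.+ + n ℚ./ 1
n/1-homo-+ m n = ℚ.toℚᵘ-injective (begin
  toℚᵘ (+ (m + n) ℚ./ 1)                    ≈⟨ toℚᵘ-n/1 (m + n) ⟩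
  mkℚᵘ (+ (m + n)) 0                        ≈⟨ *≡* (cong (ℤ._* + 1) (cong₂ ℤ._+_ (sym (ℤ.*-identityʳ (+ m))) (sym (ℤ.*-identityʳ (+ n))))) ⟩
  mkℚᵘ (+ m) 0 ℚᵘ.+ mkℚᵘ (+ n) 0            ≈⟨ ℚᵘ.+-cong (toℚᵘ-n/1 m) (toℚᵘ-n/1 n) ⟨
  toℚᵘ (+ m ℚ./ 1) ℚᵘ.+ toℚᵘ (+ n ℚ./ 1)    ≈⟨ ℚ.toℚᵘ-homo-+ (+ m ℚ./ 1) (+ n ℚ./ 1) ⟨
  toℚᵘ (+ m ℚ./ 1 ℚ.+ + n ℚ./ 1)            ∎)
  where open import Relation.Binary.Reasoning.Setoid ℚᵘ.≃-setoid

≤-archimedean : ∀ q → ∃[ n ] q ℚ.≤ + n ℚ./ 1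
≤-archimedean q@record{} = n , ℚ.toℚᵘ-cancel-≤
  (ℚᵘ.≤-respʳ-≃ (ℚᵘ.≃-sym (toℚᵘ-n/1 n)) (bound (ℚ.numerator q) (ℚ.denominator-1 q)))
  where
  n = ℤ.∣ ℚ.numerator q ∣

  bound : ∀ z d → mkℚᵘ z d ℚᵘ.≤ mkℚᵘ (+ ℤ.∣ z ∣) 0
  bound (+ m)    d = *≤* (ℤ.*-monoˡ-≤-nonNeg (+ m) (ℤ.+≤+ (s≤s z≤n)))
  bound -[1+ m ] d = *≤* (ℤ.≤-trans ℤ.-≤+ (ℤ.≤-reflexive (ℤ.pos-* (suc m) (suc d))))

fromℕ-mono : ∀ {m n} → m ≤ n → fromℕ m ≤ʳ fromℕ n
fromℕ-mono m≤n q<m = ℚ.<-≤-trans q<m (n/1-mono-≤ m≤n)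

-- The sum of cuts asks for summands strictly below `m` and `n`. A rational `q′` strictly between
-- `q` and `m + n` gives each of them some slack.
fromℕ-+ : ∀ m n → fromℕ (m + n) ≤ʳ fromℕ m +ʳ fromℕ n
fromℕ-+ m n {q} q<m+n with ℚ.<-dense q<m+n
... | q′ , q<q′ , q′<m+n = M ℚ.+ (q ℚ.- q′) , q′ ℚ.- M , below-m , below-n , sym (sums M)
  where
  M = + m ℚ./ 1
  N = + n ℚ./ 1

  cancel : ∀ a b → (a ℚ.+ b) ℚ.- a ≡ b
  cancel a b = begin
    (a ℚ.+ b) ℚ.- a   ≡⟨ cong (ℚ._- a) (ℚ.+-comm a b) ⟩
    (b ℚ.+ a) ℚ.- a   ≡⟨ ℚ.+-assoc b a (ℚ.- a) ⟩
    b ℚ.+ (a ℚ.- a)   ≡⟨ cong (b ℚ.+_) (ℚ.+-inverseʳ a) ⟩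
    b ℚ.+ ℚ.0ℚ        ≡⟨ ℚ.+-identityʳ b ⟩
    b                 ∎
    where open ≡-Reasoning

  sums : ∀ a → a ℚ.+ (q ℚ.- q′) ℚ.+ (q′ ℚ.- a) ≡ q
  sums a = begin
    a ℚ.+ (q ℚ.- q′) ℚ.+ (q′ ℚ.- a)    ≡⟨ cong (ℚ._+ (q′ ℚ.- a)) (ℚ.+-comm a (q ℚ.- q′)) ⟩
    q ℚ.- q′ ℚ.+ a ℚ.+ (q′ ℚ.- a)      ≡⟨ ℚ.+-assoc (q ℚ.- q′) a (q′ ℚ.- a) ⟩
    q ℚ.- q′ ℚ.+ (a ℚ.+ (q′ ℚ.- a))    ≡⟨ cong (q ℚ.- q′ ℚ.+_) (trans (sym (ℚ.+-assoc a q′ (ℚ.- a))) (cancel a q′)) ⟩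
    q ℚ.- q′ ℚ.+ q′                    ≡⟨ ℚ.+-assoc q (ℚ.- q′) q′ ⟩
    q ℚ.+ (ℚ.- q′ ℚ.+ q′)              ≡⟨ cong (q ℚ.+_) (ℚ.+-inverseˡ q′) ⟩
    q ℚ.+ ℚ.0ℚ                         ≡⟨ ℚ.+-identityʳ q ⟩
    q                                  ∎
    where open ≡-Reasoning

  below-m : M ℚ.+ (q ℚ.- q′) ℚ.< M
  below-m = subst (M ℚ.+ (q ℚ.- q′) ℚ.<_)
    (trans (cong (M ℚ.+_) (ℚ.+-inverseʳ q′)) (ℚ.+-identityʳ M))
    (ℚ.+-monoʳ-< M (ℚ.+-monoˡ-< (ℚ.- q′) q<q′))

  below-n : q′ ℚ.- M ℚ.< N
  below-n = subst (q′ ℚ.- M ℚ.<_) (cancel M N)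
    (ℚ.+-monoˡ-< (ℚ.- M) (subst (q′ ℚ.<_) (n/1-homo-+ m n) q′<m+n))

+ʳ-monoˡ : ∀ {x y} z → x ≤ʳ y → x +ʳ z ≤ʳ y +ʳ z
+ʳ-monoˡ z x≤y (a , b , a∈x , b∈z , eq) = a , b , x≤y a∈x , b∈z , eq

fromℕ-· : ∀ m n → fromℕ (n * m) ≤ʳ fromℕ m ·ʳ n
fromℕ-· m zero    q<0 = q<0
fromℕ-· m (suc n) {q} q<m+nm =
  +ʳ-monoˡ {fromℕ (n * m)} {fromℕ m ·ʳ n} (fromℕ m) (λ {p} → fromℕ-· m n {p})
    (fromℕ-+ (n * m) m (subst (λ i → q ℚ.< + i ℚ./ 1) (ℕ.+-comm m (n * m)) q<m+nm))

fromℕ-affine : ∀ {d} n m c → d ≤ n * m + c → fromℕ d ≤ʳ fromℕ m ·ʳ n +ʳ fromℕ c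
fromℕ-affine n m c d≤ q<d =
  +ʳ-monoˡ {fromℕ (n * m)} {fromℕ m ·ʳ n} (fromℕ c) (λ {p} → fromℕ-· m n {p})
    (fromℕ-+ (n * m) c (fromℕ-mono d≤ q<d))

-- Distances are natural numbers, so the real `r` enters the construction only through this `R`.
ℕ-bound : ∀ (r : ℝ) → ∃[ R ] (∀ {d} → fromℕ d ≤ʳ r → d ≤ R)
ℕ-bound r with ℝ.bounded r
... | u , r<u with ≤-archimedean u
... | R , u≤R = R , λ {d} d≤r → ℕ.≮⇒≥ λ R<d →
  ℚ.<-irrefl refl (ℚ.<-≤-trans (r<u (d≤r (n/1-mono-< R<d))) u≤R)
  where
  n/1-mono-< : ∀ {m n} → m < n → + m ℚ./ 1 ℚ.< + n ℚ./ 1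
  n/1-mono-< {m} {n} m<n = ℚ.toℚᵘ-cancel-<
    (ℚᵘ.<-respˡ-≃ (ℚᵘ.≃-sym (toℚᵘ-n/1 m)) (ℚᵘ.<-respʳ-≃ (ℚᵘ.≃-sym (toℚᵘ-n/1 n))
      (*<* (ℤ.*-monoʳ-<-pos (+ 1) (ℤ.+<+ m<n)))))

-- Walks and distances

module _ (G : Graph ℓ) where
  open Graph G using (Adj; symm)

  -- Walks instead of paths, so that concatenation needs no shortening; `near⇒dist` returns to paths
  -- at the end.
  Near : ℕ → V G → V G → Set ℓ
  Near n u v = ∃[ p ] edges G {u} {v} p ≤ n

  infixr 5 _++ʷ_

  _++ʷ_ : ∀ {u v w} → Walk G u v → Walk G v w → Walk G u w
  nil      ++ʷ q = q
  cons e p ++ʷ q = cons e (p ++ʷ q)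

  edges-++ʷ : ∀ {u v w} (p : Walk G u v) (q : Walk G v w) →
              edges G (p ++ʷ q) ≡ edges G p + edges G q
  edges-++ʷ nil        q = refl
  edges-++ʷ (cons _ p) q = cong suc (edges-++ʷ p q)

  near-refl : ∀ {n v} → Near n v v
  near-refl = nil , z≤n

  near-adj : ∀ {u v} → Adj u v → Near 1 u v
  near-adj e = cons e nil , s≤s z≤n

  near-trans : ∀ {m n u v w} → Near m u v → Near n v w → Near (m + n) u w
  near-trans {m} {n} (p , p≤m) (q , q≤n) =
    p ++ʷ q , subst (_≤ m + n) (sym (edges-++ʷ p q)) (ℕ.+-mono-≤ p≤m q≤n)

  near-weaken : ∀ {m n u v} → m ≤ n → Near m u v → Near n u v
  near-weaken m≤n (p , p≤m) = p , ℕ.≤-trans p≤m m≤n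

  near-sym : ∀ {n u v} → Near n u v → Near n v u
  near-sym (nil , _)                  = near-refl
  near-sym {suc n} (cons e p , s≤s p≤n) =
    near-weaken (ℕ.≤-reflexive (ℕ.+-comm n 1)) (near-trans (near-sym (p , p≤n)) (near-adj (symm e)))

  suffix : ∀ {u v x} (p : Walk G u v) → x ∈ vertices G p → IsPath G p →
           ∃[ q ] (IsPath G {x} {v} q × edges G q ≤ edges G p)
  suffix p@nil        (here refl) up       = p , up , ℕ.≤-refl
  suffix p@(cons _ _) (here refl) up       = p , up , ℕ.≤-refl
  suffix (cons _ p)   (there x∈p) (_ ∷ up) with suffix p x∈p up
  ... | q , uq , q≤p = q , uq , ℕ.m≤n⇒m≤1+n q≤p

module _ (em : ∀ {a} → ExcludedMiddle a) (G : Graph ℓ) where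

  shorten : ∀ {u v} (p : Walk G u v) → ∃[ q ] (IsPath G {u} {v} q × edges G q ≤ edges G p)
  shorten nil = nil , [] ∷ [] , z≤n
  shorten {u} (cons e p) with shorten p
  ... | q , uq , q≤p with em {P = u ∈ vertices G q}
  ...   | yes u∈q = let (s , us , s≤q) = suffix G q u∈q uq
                    in s , us , ℕ.m≤n⇒m≤1+n (ℕ.≤-trans s≤q q≤p)
  ...   | no  u∉q = cons e q , ¬Any⇒All¬ _ u∉q ∷ uq , s≤s q≤p

  near⇒dist : ∀ n {u v} → Near G n u v → ∃[ d ] (IsDist G u v d × d ≤ n)
  near⇒dist n {u} {v} (p , p≤n) with shorten p
  ... | q , uq , q≤p = shortest n q uq (ℕ.≤-trans q≤p p≤n)
    where
    shortest : ∀ n (q : Walk G u v) → IsPath G q → edges G q ≤ n → ∃[ d ] (IsDist G u v d × d ≤ n)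
    shortest n q uq q≤n with em {P = ∃[ q′ ] (IsPath G {u} {v} q′ × edges G q′ < edges G q)}
    shortest n q uq q≤n | no ∄shorter =
      edges G q , ((q , uq , refl) , λ q′ uq′ → ℕ.≮⇒≥ λ q′<q → ∄shorter (q′ , uq′ , q′<q)) , q≤n
    shortest zero    q uq q≤n | yes (q′ , uq′ , q′<q) = contradiction (ℕ.≤-trans q′<q q≤n) λ ()
    shortest (suc n) q uq q≤n | yes (q′ , uq′ , q′<q) =
      let (d , isd , d≤n) = shortest n q′ uq′ (ℕ.s≤s⁻¹ (ℕ.≤-trans q′<q q≤n))
      in d , isd , ℕ.m≤n⇒m≤1+n d≤n

  near⇒DistAtMost : ∀ {n u v} x → fromℕ n ≤ʳ x → Near G n u v → DistAtMost G u v x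
  near⇒DistAtMost {n} x n≤x near with near⇒dist n near
  ... | d , isd , d≤n = d , isd , λ q<d → n≤x (fromℕ-mono d≤n q<d)

-- Compactness

infix 4 _∈ˢ_ _⊆ˢ_

-- `Pred X ℓ` would lie one universe higher than `X : Set ℓ`, whereas nodes and cuts contain subsets
-- of the line and `H` has to be a `Graph ℓ`.
Subset : Set a → Set a
Subset X = X → Bool

_∈ˢ_ : {X : Set a} → X → Subset X → Set
x ∈ˢ S = T (S x)

_⊆ˢ_ : {X : Set a} → Subset X → Subset X → Set a
S ⊆ˢ S′ = ∀ {x} → x ∈ˢ S → x ∈ˢ S′

⊆ˢ-antisym : (∀ {a b} → Extensionality a b) → {X : Set a} {S S′ : Subset X} → S ⊆ˢ S′ → S′ ⊆ˢ S → S ≡ S′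
⊆ˢ-antisym ext {S = S} {S′} S⊆S′ S′⊆S = ext λ x → antisym (S x) (S′ x) S⊆S′ S′⊆S
  where
  antisym : ∀ b c → (T b → T c) → (T c → T b) → b ≡ c
  antisym false false _ _ = refl
  antisym true  true  _ _ = refl
  antisym false true  _ g with () ← g _
  antisym true  false f _ with () ← f _

module Comprehension (em : ∀ {a} → ExcludedMiddle a) where

  ⟦_⟧ : {X : Set a} → (X → Set b) → Subset X
  ⟦ P ⟧ x = ⌊ em {P = P x} ⌋

  ∈⁺ : {X : Set a} (P : X → Set b) {x : X} → P x → x ∈ˢ ⟦ P ⟧
  ∈⁺ P = fromWitness

  ∈⁻ : {X : Set a} (P : X → Set b) {x : X} → x ∈ˢ ⟦ P ⟧ → P x
  ∈⁻ P = toWitness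

-- The Teichmüller–Tukey lemma. Subsets are Bool-valued so that extensionally equal ones are
-- equal; the tower of all stages of the construction is then a chain, because each step adds at
-- most one element.
module Tukey (em : ∀ {a} → ExcludedMiddle a) (ext : ∀ {a b} → Extensionality a b)
             {X : Set a} (Good : List X → Set b) (good[] : Good []) where
  open Comprehension em

  Consistent : Subset X → Set (a ⊔ b)
  Consistent S = ∀ xs → All (_∈ˢ S) xs → Good xs

  insert : X → Subset X → Subset X
  insert x S = ⟦ (λ y → y ∈ˢ S ⊎ y ≡ x) ⟧

  Extension : Subset X → Set (a ⊔ b)
  Extension S = ∃[ x ] (¬ x ∈ˢ S × Consistent (insert x S))

  extend : Subset X → Subset X
  extend S with em {P = Extension S}
  ... | yes (x , _) = insert x S
  ... | no  _       = S

  extend-⊇ : ∀ S → S ⊆ˢ extend S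
  extend-⊇ S x∈S with em {P = Extension S}
  ... | yes (x , _) = ∈⁺ (λ y → y ∈ˢ S ⊎ y ≡ x) (inj₁ x∈S)
  ... | no  _       = x∈S

  extend-new : ∀ S {x y} → x ∈ˢ extend S → ¬ x ∈ˢ S → y ∈ˢ extend S → ¬ y ∈ˢ S → x ≡ y
  extend-new S x∈ x∉ y∈ y∉ with em {P = Extension S}
  ... | no  _       = contradiction x∈ x∉
  ... | yes (z , _) with ∈⁻ (λ y → y ∈ˢ S ⊎ y ≡ z) x∈ | ∈⁻ (λ y → y ∈ˢ S ⊎ y ≡ z) y∈
  ...   | inj₁ x∈S | _        = contradiction x∈S x∉
  ...   | inj₂ _   | inj₁ y∈S = contradiction y∈S y∉
  ...   | inj₂ x≡z | inj₂ y≡z = trans x≡z (sym y≡z)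

  extend-proper : ∀ S → Extension S → ∃[ y ] (y ∈ˢ extend S × ¬ y ∈ˢ S)
  extend-proper S e with em {P = Extension S}
  ... | yes (y , y∉S , _) = y , ∈⁺ (λ z → z ∈ˢ S ⊎ z ≡ y) (inj₂ refl) , y∉S
  ... | no  ∄             = contradiction e ∄

  extend-consistent : ∀ S → Consistent S → Consistent (extend S)
  extend-consistent S con with em {P = Extension S}
  ... | yes (_ , _ , con′) = con′
  ... | no  _              = con

  ⋃ : Subset (Subset X) → Subset X
  ⋃ P = ⟦ (λ x → ∃[ S ] (S ∈ˢ P × x ∈ˢ S)) ⟧

  ⋃-⊇ : ∀ P {S} → S ∈ˢ P → S ⊆ˢ ⋃ P
  ⋃-⊇ P S∈P x∈S = ∈⁺ (λ x → ∃[ S ] (S ∈ˢ P × x ∈ˢ S)) (_ , S∈P , x∈S)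

  ⋃-⊆ : ∀ P {S} → (∀ {S′} → S′ ∈ˢ P → S′ ⊆ˢ S) → ⋃ P ⊆ˢ S
  ⋃-⊆ P below x∈⋃ with ∈⁻ (λ x → ∃[ S ] (S ∈ˢ P × x ∈ˢ S)) x∈⋃
  ... | _ , S∈P , x∈S = below S∈P x∈S

  data Tower : Subset X → Set a where
    step  : ∀ {S} → Tower S → Tower (extend S)
    union : ∀ P → (∀ {S} → S ∈ˢ P → Tower S) → Tower (⋃ P)

  Comparable : Subset X → Set a
  Comparable C = ∀ {A} → Tower A → A ⊆ˢ C ⊎ C ⊆ˢ A

  -- The critical case is that of `C` between `A` and `extend A`: as `extend` adds at most one
  -- element, `C` equals `A` or contains all of `extend A`.
  comparable-step : ∀ {C} → Comparable C → ∀ {A} → Tower A → A ⊆ˢ C ⊎ extend C ⊆ˢ A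
  comparable-step {C} cmp (union P tower)
    with em {P = ∃[ A ] (A ∈ˢ P × extend C ⊆ˢ A)}
  ... | yes (A , A∈P , eC⊆A) = inj₂ λ x∈eC → ⋃-⊇ P A∈P (eC⊆A x∈eC)
  ... | no  ∄A = inj₁ (⋃-⊆ P below)
    where
    below : ∀ {A} → A ∈ˢ P → A ⊆ˢ C
    below A∈P with comparable-step cmp (tower A∈P)
    ... | inj₁ A⊆C  = A⊆C
    ... | inj₂ eC⊆A = contradiction (_ , A∈P , λ {x} → eC⊆A {x}) ∄A
  comparable-step {C} cmp (step {A} tA) with comparable-step cmp tA | cmp (step tA)
  ... | inj₂ eC⊆A | _         = inj₂ λ x∈eC → extend-⊇ A (eC⊆A x∈eC)
  ... | inj₁ _    | inj₁ eA⊆C = inj₁ eA⊆C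
  ... | inj₁ A⊆C  | inj₂ C⊆eA with em {P = ∃[ x ] (x ∈ˢ C × ¬ x ∈ˢ A)}
  ...   | no  C⊆A = inj₂ λ {x} → subst (λ S → x ∈ˢ extend S) (⊆ˢ-antisym ext C⊆A′ A⊆C)
    where
    C⊆A′ : C ⊆ˢ A
    C⊆A′ {x} x∈C with em {P = x ∈ˢ A}
    ... | yes x∈A = x∈A
    ... | no  x∉A = contradiction (x , x∈C , x∉A) C⊆A
  ...   | yes (x , x∈C , x∉A) = inj₁ eA⊆C
    where
    eA⊆C : extend A ⊆ˢ C
    eA⊆C {y} y∈eA with em {P = y ∈ˢ A}
    ... | yes y∈A = A⊆C y∈A
    ... | no  y∉A = subst (_∈ˢ C) (extend-new A (C⊆eA x∈C) x∉A y∈eA y∉A) x∈C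

  comparable : ∀ {C} → Tower C → Comparable C
  comparable (step {C} tC) tA with comparable-step (comparable tC) tA
  ... | inj₁ A⊆C  = inj₁ λ x∈A → extend-⊇ C (A⊆C x∈A)
  ... | inj₂ eC⊆A = inj₂ eC⊆A
  comparable (union P tower) {A} tA with em {P = ∃[ C ] (C ∈ˢ P × A ⊆ˢ C)}
  ... | yes (C , C∈P , A⊆C) = inj₁ λ x∈A → ⋃-⊇ P C∈P (A⊆C x∈A)
  ... | no  ∄C = inj₂ (⋃-⊆ P above)
    where
    above : ∀ {C} → C ∈ˢ P → C ⊆ˢ A
    above C∈P with comparable (tower C∈P) tA
    ... | inj₁ A⊆C = contradiction (_ , C∈P , λ {x} → A⊆C {x}) ∄C
    ... | inj₂ C⊆A = C⊆A

  -- Consistency is finitary: as the tower is a chain, finitely many elements of a union lie in a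
  -- single stage.
  tower-consistent : ∀ {S} → Tower S → Consistent S
  tower-consistent (step {S} tS) = extend-consistent S (tower-consistent tS)
  tower-consistent (union P tower) [] _ = good[]
  tower-consistent (union P tower) (x ∷ xs) all
    with common x xs all
    where
    common : ∀ x xs → All (_∈ˢ ⋃ P) (x ∷ xs) → ∃[ S ] (S ∈ˢ P × All (_∈ˢ S) (x ∷ xs))
    common x xs (x∈⋃ ∷ xs∈⋃) with ∈⁻ (λ x → ∃[ S ] (S ∈ˢ P × x ∈ˢ S)) x∈⋃
    common x []       _           | S , S∈P , x∈S = S , S∈P , x∈S ∷ []
    common x (y ∷ ys) (_ ∷ ys∈⋃) | S , S∈P , x∈S with common y ys ys∈⋃
    ... | S′ , S′∈P , ys∈S′ with comparable (tower S∈P) (tower S′∈P)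
    ...   | inj₁ S′⊆S = S , S∈P , x∈S ∷ All.map S′⊆S ys∈S′
    ...   | inj₂ S⊆S′ = S′ , S′∈P , S⊆S′ x∈S ∷ ys∈S′
  ... | S , S∈P , xs∈S = tower-consistent (tower S∈P) (x ∷ xs) xs∈S

  maximal : Subset X
  maximal = ⋃ ⟦ Tower ⟧

  maximal-tower : Tower maximal
  maximal-tower = union ⟦ Tower ⟧ (∈⁻ Tower)

  maximal-consistent : Consistent maximal
  maximal-consistent = tower-consistent maximal-tower

  maximal-maximal : ∀ x → Consistent (insert x maximal) → x ∈ˢ maximal
  maximal-maximal x con with em {P = x ∈ˢ maximal}
  ... | yes x∈M = x∈M
  ... | no  x∉M with extend-proper maximal (x , x∉M , con)
  ...   | y , y∈eM , y∉M = contradiction (⋃-⊇ ⟦ Tower ⟧ (∈⁺ Tower (step maximal-tower)) y∈eM) y∉M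

-- An ultrafilter on the finite subsets of A that contains every cone { F : F₀ ⊆ F }.
module Ultrafilter (em : ∀ {a} → ExcludedMiddle a) (ext : ∀ {a b} → Extensionality a b)
                   (A : Set a) where
  open Comprehension em

  -- Asking for a common member in every cone builds the cones into the notion of consistency, so
  -- that the maximal family contains them although it is grown from the empty one.
  Cofinal : List (Subset (List A)) → Set a
  Cofinal Ps = ∀ F₀ → ∃[ F ] (F₀ ⊆ F × All (F ∈ˢ_) Ps)

  cofinal[] : Cofinal []
  cofinal[] F₀ = F₀ , id , []

  open Tukey em ext Cofinal cofinal[]
    using (Consistent; insert; maximal; maximal-consistent; maximal-maximal)

  -- A record, because unification cannot recover `P` from the Boolean value behind
  -- `⟦ P ⟧ ∈ˢ maximal`.
  record Large (P : List A → Set) : Set where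
    constructor large
    field
      is-member : ⟦ P ⟧ ∈ˢ maximal
  open Large

  witness : ∀ {P} → Large P → ∀ F₀ → ∃[ F ] (F₀ ⊆ F × P F)
  witness {P} lP F₀ with maximal-consistent (⟦ P ⟧ ∷ []) (is-member lP ∷ []) F₀
  ... | F , F₀⊆F , F∈P ∷ [] = F , F₀⊆F , ∈⁻ P F∈P

  private
    split : ∀ S Ps → All (_∈ˢ insert S maximal) Ps →
            ∃[ Qs ] (All (_∈ˢ maximal) Qs × (∀ F → F ∈ˢ S → All (F ∈ˢ_) Qs → All (F ∈ˢ_) Ps))
    split S []       []       = [] , [] , λ _ _ _ → []
    split S (P ∷ Ps) (P∈ ∷ Ps∈) with split S Ps Ps∈ | ∈⁻ (λ P → P ∈ˢ maximal ⊎ P ≡ S) P∈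
    ... | Qs , Qs∈M , out | inj₁ P∈M  = P ∷ Qs , P∈M ∷ Qs∈M , λ { F F∈S (F∈P ∷ F∈Qs) → F∈P ∷ out F F∈S F∈Qs }
    ... | Qs , Qs∈M , out | inj₂ refl = Qs , Qs∈M , λ F F∈S F∈Qs → F∈S ∷ out F F∈S F∈Qs

    Refuted : Subset (List A) → Set a
    Refuted S = ∃[ Qs ] (All (_∈ˢ maximal) Qs × ∃[ F₀ ] (∀ F → F₀ ⊆ F → All (F ∈ˢ_) Qs → ¬ F ∈ˢ S))

    -- If no finite part of the family together with a cone excluded `S`, then adding `S` would be
    -- consistent, against maximality.
    refuted : ∀ S → ¬ S ∈ˢ maximal → Refuted S
    refuted S S∉M with em {P = Refuted S}
    ... | yes found = found
    ... | no  ∄     = contradiction (maximal-maximal S consistent) S∉M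
      where
      consistent : Consistent (insert S maximal)
      consistent Ps Ps∈ F₀ with split S Ps Ps∈
      ... | Qs , Qs∈M , out with em {P = ∃[ F ] (F₀ ⊆ F × F ∈ˢ S × All (F ∈ˢ_) Qs)}
      ...   | yes (F , F₀⊆F , F∈S , F∈Qs) = F , F₀⊆F , out F F∈S F∈Qs
      ...   | no  ∄F = contradiction (Qs , Qs∈M , F₀ , λ F F₀⊆F F∈Qs F∈S → ∄F (F , (λ {x} → F₀⊆F {x}) , F∈S , F∈Qs)) ∄

  dichotomy : ∀ P → Large P ⊎ Large (λ F → ¬ P F)
  dichotomy P with em {P = ⟦ P ⟧ ∈ˢ maximal} | em {P = ⟦ (λ F → ¬ P F) ⟧ ∈ˢ maximal}
  ... | yes P∈M | _        = inj₁ (large P∈M)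
  ... | no  _   | yes ¬P∈M = inj₂ (large ¬P∈M)
  ... | no  P∉M | no  ¬P∉M with refuted _ P∉M | refuted _ ¬P∉M
  ...   | Qs , Qs∈M , F₀ , outside | Qs′ , Qs′∈M , F₀′ , outside′
    -- A common member of both finite parts and both cones would lie neither in `P` nor in its
    -- complement.
    with maximal-consistent (Qs ++ Qs′) (++⁺ Qs∈M Qs′∈M) (F₀ ++ F₀′)
  ...   | F , F₀⊆F , F∈Qs++Qs′ = contradiction (∈⁺ (λ F → ¬ P F) λ PF → ¬P (∈⁺ P PF)) ¬¬P
    where
    ¬P  = outside F (λ x∈ → F₀⊆F (xs⊆xs++ys F₀ F₀′ x∈)) (++⁻ˡ Qs F∈Qs++Qs′)
    ¬¬P = outside′ F (λ x∈ → F₀⊆F (xs⊆ys++xs F₀′ F₀ x∈)) (++⁻ʳ Qs F∈Qs++Qs′)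

  large-∩ : ∀ {P Q} → Large P → Large Q → Large (λ F → P F × Q F)
  large-∩ {P} {Q} lP lQ with dichotomy (λ F → P F × Q F)
  ... | inj₁ lPQ  = lPQ
  ... | inj₂ l¬PQ with maximal-consistent (⟦ P ⟧ ∷ ⟦ Q ⟧ ∷ _ ∷ []) (is-member lP ∷ is-member lQ ∷ is-member l¬PQ ∷ []) []
  ...   | F , _ , F∈P ∷ F∈Q ∷ F∉PQ ∷ [] =
    contradiction (∈⁻ P F∈P , ∈⁻ Q F∈Q) (∈⁻ (λ F → ¬ (P F × Q F)) F∉PQ)

  transfer : ∀ {P Q} F₀ → Large P → (∀ {F} → F₀ ⊆ F → P F → Q F) → Large Q
  transfer {P} {Q} F₀ lP P⇒Q with dichotomy Q
  ... | inj₁ lQ  = lQ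
  ... | inj₂ l¬Q with witness (large-∩ lP l¬Q) F₀
  ...   | F , F₀⊆F , PF , ¬QF = contradiction (P⇒Q F₀⊆F PF) ¬QF

  large-cone : ∀ {P} F₀ → (∀ {F} → F₀ ⊆ F → P F) → Large P
  large-cone {P} F₀ cone with dichotomy P
  ... | inj₁ lP  = lP
  ... | inj₂ l¬P = transfer F₀ l¬P λ F₀⊆F _ → cone F₀⊆F

  large-value : ∀ (f : List A → ℕ) k → Large (λ F → f F < k) → ∃[ i ] (i < k × Large (λ F → f F ≡ i))
  large-value f zero    l<k with () ← proj₂ (proj₂ (witness l<k []))
  large-value f (suc k) l<k with dichotomy (λ F → f F ≡ k)
  ... | inj₁ l≡k = k , ℕ.n<1+n k , l≡k
  ... | inj₂ l≢k with large-value f k (transfer [] (large-∩ l<k l≢k) λ _ (<k , ≢k) → ℕ.≤∧≢⇒< (ℕ.s≤s⁻¹ <k) ≢k)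
  ...   | i , i<k , l≡i = i , ℕ.m<n⇒m<1+n i<k , l≡i

-- Finite lines

-- Two vertices of a period are each within `R + R` of their common head.
periodDiameter : ℕ → ℕ
periodDiameter R = (R + R) + (R + R)

module _ (em : ∀ {a} → ExcludedMiddle a) (G : Graph ℓ) (R : ℕ) where

  -- A choice of piece for every membership replaces the union of sets. As nearness is measured in
  -- all of `G`, a cover restricts to the vertices that remain after a sweep.
  Cover : ℕ → Pred (V G) ℓ → Set ℓ
  Cover k B = ∃ λ (piece : ∀ {v} → B v → Fin k) →
              ∀ {u v} (u∈B : B u) (v∈B : B v) → piece u∈B ≡ piece v∈B → Near G R u v

  Convex : (ℕ → Pred (V G) ℓ) → Set ℓ
  Convex A = ∀ {v i j m} → i ≤ j → j ≤ m → A i v → A m v → A j v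

  -- Same l is the equivalence relation whose classes are the periods of level l.
  record Layering {t} {Time : Set t} (_≼_ : Time → Time → Set t)
                  (A : Time → Pred (V G) ℓ) (k : ℕ) : Set (lsuc 0ℓ ⊔ ℓ ⊔ t) where
    field
      level          : Time → V G → ℕ
      Same           : ℕ → Time → Time → Set
      level<         : ∀ {i v} → A i v → level i v < k
      level-antitone : ∀ {i j v} → i ≼ j → A i v → A j v → level j v ≤ level i v
      same-refl      : ∀ {l i} → Same l i i
      same-sym       : ∀ {l i j} → Same l i j → Same l j i
      same-trans     : ∀ {l i j m} → Same l i j → Same l j m → Same l i m
      same-convex    : ∀ {l i j m} → i ≼ j → j ≼ m → Same l i m → Same l i j
      -- This says, in terms of three times only, that a vertex meets at most two periods of a
      -- level.
      two-periods    : ∀ {l i j m v} → i ≼ j → j ≼ m → A i v → A j v → A m v →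
                       level i v ≡ l → level j v ≡ l → level m v ≡ l → Same l i j ⊎ Same l j m
      same-near      : ∀ {l i j u v} → A i u → A j v → level i u ≡ l → level j v ≡ l →
                       Same l i j → Near G (periodDiameter R) u v

  module Sweep (A : ℕ → Pred (V G) ℓ) (convex : Convex A)
               (horizon : ℕ) (A⇒<horizon : ∀ {i v} → A i v → i < horizon) where

    Outlives : ℕ → V G → V G → Set ℓ
    Outlives i x v = ∀ {j} → i ≤ j → A j v → A j x

    -- The bound `b` on the lives of all candidates descends from the horizon until some candidate
    -- is alive at `b`; that one lives longest.
    longest-lived : ∀ {q} i (Q : Pred (V G) q) → ∃[ v ] (Q v × A i v) →
                    ∃[ x ] (Q x × A i x × (∀ {v} → Q v → A i v → Outlives i x v))
    longest-lived i Q start = search horizon (λ _ _ _ → A⇒<horizon)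
      where
      search : ∀ b → (∀ {v j} → Q v → A i v → i ≤ j → A j v → j < b) →
               ∃[ x ] (Q x × A i x × (∀ {v} → Q v → A i v → Outlives i x v))
      search zero bound =
        let (_ , Qv , Av) = start in contradiction (bound Qv Av ℕ.≤-refl Av) λ ()
      search (suc b) bound with em {P = ∃[ x ] (Q x × A i x × A b x)}
      ... | yes (x , Qx , Ax , Abx) =
        x , Qx , Ax , λ Qv Av i≤j Ajv → convex i≤j (ℕ.s≤s⁻¹ (bound Qv Av i≤j Ajv)) Ax Abx
      ... | no  ∄x = search b λ Qv Av i≤j Ajv →
        ℕ.≤∧≢⇒< (ℕ.s≤s⁻¹ (bound Qv Av i≤j Ajv)) λ { refl → ∄x (_ , Qv , Av , Ajv) }

    record State : Set (lsuc ℓ) where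
      field
        head     : V G
        clock    : ℕ
        Captured : Pred (V G) ℓ
    open State

    -- When nobody is alive at time i, the new head is arbitrary.
    data Next (s : State) (i : ℕ) : V G → ℕ → Set ℓ where
      stay : A i (head s) → Next s i (head s) (clock s)
      move : ∀ {x} → ¬ A i (head s) → (∀ {v} → A i v → A i x) →
             (∀ {v} → Captured s v → A i v → Captured s x × Outlives i x v) →
             Next s i x (suc (clock s))

    next : ∀ s i → ∃[ x ] ∃[ n ] Next s i x n
    next s i with em {P = A i (head s)}
    ... | yes alive = _ , _ , stay alive
    ... | no  dead with em {P = ∃[ v ] (Captured s v × A i v)}
    ...   | yes candidate with longest-lived i (Captured s) candidate
    ...     | x , cap , Ax , outlives = x , _ , move dead (λ _ → Ax) λ cap-v Av → cap , outlives cap-v Av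
    next s i | no dead | no ∄cap with em {P = ∃[ v ] A i v}
    ... | yes (x , Ax) = x , _ , move dead (λ _ → Ax) λ cap-v Av → contradiction (_ , cap-v , Av) ∄cap
    ... | no  ∄v       = head s , _ ,
      move dead (λ Av → contradiction (_ , Av) ∄v) λ cap-v Av → contradiction (_ , cap-v , Av) ∄cap

    advance : ℕ → State → State
    advance i s = record
      { head     = proj₁ (next s i)
      ; clock    = proj₁ (proj₂ (next s i))
      ; Captured = λ v → A i v × (Near G R (proj₁ (next s i)) v ⊎ Captured s v)
      }

    module Run (v₀ : V G) where

      before : ℕ → State
      before zero    = record { head = v₀ ; clock = 0 ; Captured = λ _ → Level.Lift ℓ ⊥ }
      before (suc i) = advance i (before i)

      x : ℕ → V G
      x i = head (before (suc i))

      p : ℕ → ℕ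
      p i = clock (before (suc i))

      Cap : ℕ → Pred (V G) ℓ
      Cap i = Captured (before (suc i))

      step : ∀ i → Next (before i) i (x i) (p i)
      step i = proj₂ (proj₂ (next (before i) i))

      -- A vertex captured under the present head is close to it but may survive it; one inherited
      -- from an earlier head may be twice as far, but dies no later than the present head.
      Tracked : ℕ → V G → Pred (V G) ℓ
      Tracked i y v = Near G R y v ⊎ (Near G (R + R) y v × Outlives i y v)

      -- When the head dies, the vertices that it outlives are dead as well. So the captured
      -- survivors, the new head among them, were within `R` of the old head, which puts them within
      -- `R + R` of the new one.
      tracked : ∀ i {v} → Cap i v → Tracked i (x i) v
      tracked i (_ , inj₁ near) = inj₁ near
      tracked (suc i) {v} (Av , inj₂ cap) = tracked-step (step (suc i))
        where
        tracked-step : ∀ {y n} → Next (before (suc i)) (suc i) y n → Tracked (suc i) y v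
        tracked-step (stay alive) with tracked i cap
        ... | inj₁ near              = inj₁ near
        ... | inj₂ (near , outlives) = inj₂ (near , λ i<j → outlives (ℕ.≤-trans (ℕ.n≤1+n i) i<j))
        tracked-step (move dead max longest) with longest cap Av
        ... | cap-y , y-outlives-v = inj₂ (near-trans G (near-sym G (reach cap-y (max Av))) (reach cap Av) , y-outlives-v)
          where
          reach : ∀ {u} → Cap i u → A (suc i) u → Near G R (x i) u
          reach cap-u Au with tracked i cap-u
          ... | inj₁ near           = near
          ... | inj₂ (_ , outlives) = contradiction (outlives (ℕ.n≤1+n i) Au) dead

      captured-near : ∀ {i v} → Cap i v → Near G (R + R) (x i) v
      captured-near {i} cap with tracked i cap
      ... | inj₁ near       = near-weaken G (ℕ.m≤m+n R R) near
      ... | inj₂ (near , _) = near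

      captured-stays : ∀ {i j v} → i ℕ.≤′ j → Cap i v → A j v → Cap j v
      captured-stays ℕ.≤′-refl       cap Av = cap
      captured-stays (ℕ.≤′-step i≤j) cap Av =
        Av , inj₂ (captured-stays i≤j cap (convex (ℕ.≤′⇒≤ i≤j) (ℕ.n≤1+n _) (proj₁ cap) Av))

      p-step : ∀ i → p i ≤ p (suc i)
      p-step i = go (step (suc i))
        where
        go : ∀ {y n} → Next (before (suc i)) (suc i) y n → p i ≤ n
        go (stay _)     = ℕ.≤-refl
        go (move _ _ _) = ℕ.n≤1+n _

      p-mono′ : ∀ {i j} → i ℕ.≤′ j → p i ≤ p j
      p-mono′ ℕ.≤′-refl       = ℕ.≤-refl
      p-mono′ (ℕ.≤′-step i≤j) = ℕ.≤-trans (p-mono′ i≤j) (p-step _)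

      p-mono : ∀ {i j} → i ≤ j → p i ≤ p j
      p-mono i≤j = p-mono′ (ℕ.≤⇒≤′ i≤j)

      same-head : ∀ {i j} → i ℕ.≤′ j → p i ≡ p j → x i ≡ x j
      same-head ℕ.≤′-refl               _     = refl
      same-head {i} (ℕ.≤′-step {j} i≤j) pi≡pj = go (step (suc j)) pi≡pj
        where
        go : ∀ {y n} → Next (before (suc j)) (suc j) y n → p i ≡ n → x i ≡ y
        go (stay _)     pi≡n  = same-head i≤j pi≡n
        go (move _ _ _) pi≡1+ = contradiction (subst (_≤ p j) pi≡1+ (p-mono′ i≤j)) (ℕ.<-irrefl refl)

      near-in-period : ∀ {i j u v} → Cap i u → Cap j v → p i ≡ p j → Near G (periodDiameter R) u v
      near-in-period {i} {j} cap-u cap-v pi≡pj =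
        near-trans G (near-sym G (captured-near cap-u))
          (subst (λ y → Near G (R + R) y _) (sym x≡) (captured-near cap-v))
        where
        x≡ : x i ≡ x j
        x≡ with ℕ.≤-total i j
        ... | inj₁ i≤j = same-head (ℕ.≤⇒≤′ i≤j) pi≡pj
        ... | inj₂ j≤i = sym (same-head (ℕ.≤⇒≤′ j≤i) (sym pi≡pj))

      -- At each change of head the successor outlives all captured vertices still alive, `v` among
      -- them.
      outlived-later : ∀ {i j v} → i ℕ.≤′ j → Cap i v → A j v → p i ≡ p j ⊎ Outlives j (x j) v
      outlived-later ℕ.≤′-refl _ _ = inj₁ refl
      outlived-later {i} {v = v} (ℕ.≤′-step {j} i≤j) cap Av = go (step (suc j))
        where
        Ajv : A j v
        Ajv = convex (ℕ.≤′⇒≤ i≤j) (ℕ.n≤1+n j) (proj₁ cap) Av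

        go : ∀ {y n} → Next (before (suc j)) (suc j) y n → p i ≡ n ⊎ Outlives (suc j) y v
        go (move _ _ longest) = inj₂ (proj₂ (longest (captured-stays i≤j cap Ajv) Av))
        go (stay _) with outlived-later i≤j cap Ajv
        ... | inj₁ pi≡pj    = inj₁ pi≡pj
        ... | inj₂ outlives = inj₂ λ j<m → outlives (ℕ.≤-trans (ℕ.n≤1+n j) j<m)

      -- The head changes only on its death, which `v` cannot survive.
      outlived-stays : ∀ {j m v} → j ℕ.≤′ m → Outlives j (x j) v → A j v → A m v → p j ≡ p m × x j ≡ x m
      outlived-stays ℕ.≤′-refl _ _ _ = refl , refl
      outlived-stays {j} {v = v} (ℕ.≤′-step {m} j≤m) outlives Aj Am = go (step (suc m))
        where
        earlier : p j ≡ p m × x j ≡ x m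
        earlier = outlived-stays j≤m outlives Aj (convex (ℕ.≤′⇒≤ j≤m) (ℕ.n≤1+n m) Aj Am)

        go : ∀ {y n} → Next (before (suc m)) (suc m) y n → p j ≡ n × x j ≡ y
        go (stay _)        = earlier
        go (move dead _ _) = contradiction
          (subst (A (suc m)) (proj₂ earlier) (outlives (ℕ.≤′⇒≤ (ℕ.≤′-step j≤m)) Am)) dead

      two-periods-at : ∀ {i j m v} → i ≤ j → j ≤ m → Cap i v → A j v → A m v → p i ≡ p j ⊎ p j ≡ p m
      two-periods-at i≤j j≤m cap Aj Am with outlived-later (ℕ.≤⇒≤′ i≤j) cap Aj
      ... | inj₁ pi≡pj    = inj₁ pi≡pj
      ... | inj₂ outlives = inj₂ (proj₁ (outlived-stays (ℕ.≤⇒≤′ j≤m) outlives Aj Am))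

      Remaining : ℕ → Pred (V G) ℓ
      Remaining i v = A i v × ¬ Cap i v

      remaining-convex : Convex Remaining
      remaining-convex i≤j j≤m (Ai , _) (Am , ¬cap) =
        Aj , λ cap → ¬cap (captured-stays (ℕ.≤⇒≤′ j≤m) cap Am)
        where Aj = convex i≤j j≤m Ai Am

      head-alive : ∀ {i v} → A i v → A i (x i)
      head-alive {i} Av = go (step i)
        where
        go : ∀ {y n} → Next (before i) i y n → A i y
        go (stay alive)   = alive
        go (move _ max _) = max Av

      -- The piece of the head has been captured, so its number is punched out. If even the head is
      -- dead, nobody is alive and nothing has to be covered.
      remaining-cover : ∀ {k i} → Cover (suc k) (A i) → Cover k (Remaining i)
      remaining-cover {i = i} (piece , near) with em {P = A i (x i)}
      ... | no  dead  = (λ (Av , _) → contradiction (head-alive Av) dead) ,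
                        λ (Av , _) → contradiction (head-alive Av) dead
      ... | yes alive =
        (λ (Av , ¬cap) → punchOut (distinct Av ¬cap)) ,
        λ (Au , ¬cap-u) (Av , ¬cap-v) eq →
          near Au Av (punchOut-injective (distinct Au ¬cap-u) (distinct Av ¬cap-v) eq)
        where
        distinct : ∀ {v} (Av : A i v) → ¬ Cap i v → piece alive ≢ piece Av
        distinct Av ¬cap eq = ¬cap (Av , inj₁ (near alive Av eq))

  empty-layering : ∀ {A k} → (∀ {i v} → ¬ A i v) → Layering _≤_ A k
  empty-layering empty = record
    { level          = λ _ _ → 0
    ; Same           = λ _ _ _ → ⊤
    ; level<         = λ Av → contradiction Av empty
    ; level-antitone = λ _ Av → contradiction Av empty
    ; same-refl      = tt
    ; same-sym       = λ _ → tt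
    ; same-trans     = λ _ _ → tt
    ; same-convex    = λ _ _ _ → tt
    ; two-periods    = λ _ _ Av → contradiction Av empty
    ; same-near      = λ Av → contradiction Av empty
    }

  -- The captured vertices form level 0 and the levels of the others are shifted up by one. A vertex
  -- can become captured but never ceases to be while it lives, so levels only fall.
  layering : ∀ k A → Convex A → ∀ horizon → (∀ {i v} → A i v → i < horizon) →
             (∀ i → Cover k (A i)) → Layering _≤_ A k
  layering zero A _ _ _ cover = empty-layering λ {i} Av → no-piece (proj₁ (cover i) Av)
    where
    no-piece : ¬ Fin 0
    no-piece ()
  layering (suc k) A convex horizon A⇒< cover with em {P = V G}
  ... | no  ∄v = empty-layering λ {_} {v} _ → ∄v v
  ... | yes v₀ = record
    { level          = λ i v → level-of i v em
    ; Same           = λ { zero i j → p i ≡ p j ; (suc l) → L.Same l }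
    ; level<         = λ Av → level-of< Av em
    ; level-antitone = λ i≤j Ai Aj → antitone i≤j Ai Aj em em
    ; same-refl      = λ { {zero} → refl ; {suc l} → L.same-refl }
    ; same-sym       = λ { {zero} → sym ; {suc l} → L.same-sym }
    ; same-trans     = λ { {zero} → trans ; {suc l} → L.same-trans }
    ; same-convex    = λ { {zero} i≤j j≤m pi≡pm →
                             ℕ.≤-antisym (p-mono i≤j) (subst (p _ ≤_) (sym pi≡pm) (p-mono j≤m))
                         ; {suc l} → L.same-convex }
    ; two-periods    = λ { {zero} → two₀ ; {suc l} → two₊ }
    ; same-near      = λ { {zero} Au Av eu ev → near-in-period (captured₀ Au em eu) (captured₀ Av em ev)
                         ; {suc l} Au Av eu ev →
                             let (Au′ , eu′) = remaining₊ Au em eu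
                                 (Av′ , ev′) = remaining₊ Av em ev
                             in L.same-near Au′ Av′ eu′ ev′ }
    }
    where
    open Sweep A convex horizon A⇒<
    open Run v₀

    remaining-layering : Layering _≤_ Remaining k
    remaining-layering = layering k Remaining remaining-convex horizon (λ (Av , _) → A⇒< Av)
                           (λ i → remaining-cover (cover i))

    module L = Layering remaining-layering

    level-of : ∀ i v → Dec (Cap i v) → ℕ
    level-of i v (yes _) = 0
    level-of i v (no  _) = suc (L.level i v)

    level-of< : ∀ {i v} → A i v → (d : Dec (Cap i v)) → level-of i v d < suc k
    level-of< Av (yes _)   = s≤s z≤n
    level-of< Av (no ¬cap) = s≤s (L.level< (Av , ¬cap))

    antitone : ∀ {i j v} → i ≤ j → A i v → A j v → (d : Dec (Cap i v)) (e : Dec (Cap j v)) →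
               level-of j v e ≤ level-of i v d
    antitone i≤j Ai Aj _          (yes _)    = z≤n
    antitone i≤j Ai Aj (yes cap)  (no ¬cap)  = contradiction (captured-stays (ℕ.≤⇒≤′ i≤j) cap Aj) ¬cap
    antitone i≤j Ai Aj (no ¬cap)  (no ¬cap′) = s≤s (L.level-antitone i≤j (Ai , ¬cap) (Aj , ¬cap′))

    captured₀ : ∀ {i v} → A i v → (d : Dec (Cap i v)) → level-of i v d ≡ 0 → Cap i v
    captured₀ _ (yes cap) _ = cap

    remaining₊ : ∀ {i v l} → A i v → (d : Dec (Cap i v)) → level-of i v d ≡ suc l →
                 Remaining i v × L.level i v ≡ l
    remaining₊ Av (no ¬cap) eq = (Av , ¬cap) , ℕ.suc-injective eq

    two₀ : ∀ {v i j m} → i ≤ j → j ≤ m → A i v → A j v → A m v →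
           level-of i v em ≡ 0 → level-of j v em ≡ 0 → level-of m v em ≡ 0 → p i ≡ p j ⊎ p j ≡ p m
    two₀ i≤j j≤m Ai Aj Am ei _ _ = two-periods-at i≤j j≤m (captured₀ Ai em ei) Aj Am

    two₊ : ∀ {v l i j m} → i ≤ j → j ≤ m → A i v → A j v → A m v →
           level-of i v em ≡ suc l → level-of j v em ≡ suc l → level-of m v em ≡ suc l →
           L.Same l i j ⊎ L.Same l j m
    two₊ i≤j j≤m Ai Aj Am ei ej em′ =
      let (Ai′ , ei′) = remaining₊ Ai em ei
          (Aj′ , ej′) = remaining₊ Aj em ej
          (Am′ , em″) = remaining₊ Am em em′
      in L.two-periods i≤j j≤m Ai′ Aj′ Am′ ei′ ej′ em″

-- Arbitrary lines

module Compactness (em : ∀ {a} → ExcludedMiddle a) (ext : ∀ {a b} → Extensionality a b)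
                   (G : Graph ℓ) (R k : ℕ) (D : LineDecomposition G)
                   (cover : ∀ t → Cover em G R k (bag D t)) where
  open LineDecomposition D using (isTotalOrder; interpolation) renaming (bag to B; Point to Λ; _≤_ to _≼_)
  module ≼ = IsTotalOrder isTotalOrder

  decTotalOrder : DecTotalOrder ℓ ℓ ℓ
  decTotalOrder = record
    { isDecTotalOrder = record { isTotalOrder = isTotalOrder ; _≟_ = λ _ _ → em ; _≤?_ = λ _ _ → em } }

  open Sort decTotalOrder using (sort; sort-↭; sort-↗)
  open DecTotalOrder decTotalOrder using (totalOrder)

  module Finite (F : List Λ) where

    times : List Λ
    times = sort F

    -- Times become indices into the sorted list, where a point of `Λ` may be repeated; beyond the
    -- end of the list nobody is alive.
    Alive : ℕ → Pred (V G) ℓ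
    Alive n v = ∃[ i ] (toℕ {length times} i ≡ n × B (lookup times i) v)

    alive-convex : Convex em G R Alive
    alive-convex n≤m m≤o (i , refl , Bi) (j , refl , Bj) =
      h , h≡ , interpolation
        (lookup-mono-≤ totalOrder (sort-↗ F) (subst (toℕ i ℕ.≤_) (sym h≡) n≤m))
        (lookup-mono-≤ totalOrder (sort-↗ F) (subst (ℕ._≤ toℕ j) (sym h≡) m≤o)) Bi Bj
      where
      m<length = ℕ.≤-<-trans m≤o (toℕ<n j)
      h  = fromℕ< m<length
      h≡ = toℕ-fromℕ< m<length

    alive-cover : ∀ n → Cover em G R k (Alive n)
    alive-cover n = (λ (i , _ , Bv) → proj₁ (cover (lookup times i)) Bv) , near
      where
      near : ∀ {u v} ((i , _ , Bu) : Alive n u) ((j , _ , Bv) : Alive n v) →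
             proj₁ (cover (lookup times i)) Bu ≡ proj₁ (cover (lookup times j)) Bv → Near G R u v
      near (i , i≡n , Bu) (j , j≡n , Bv) eq with toℕ-injective (trans i≡n (sym j≡n))
      ... | refl = proj₂ (cover (lookup times i)) Bu Bv eq

    rank-of : ∀ {t} → Dec (t ∈ times) → ℕ
    rank-of (yes t∈) = toℕ (index t∈)
    -- A default: lives and order are compared only for points of `F`.
    rank-of (no  _)  = 0

    rank : Λ → ℕ
    rank t = rank-of {t} em

    alive-rank : ∀ {t v} → t ∈ F → B t v → Alive (rank t) v
    alive-rank {t} {v} t∈F Bt with em {P = t ∈ times}
    ... | yes t∈ = index t∈ , refl , subst (λ s → B s v) (lookup-index t∈) Bt
    ... | no  t∉ = contradiction (∈-resp-↭ (↭-sym (sort-↭ F)) t∈F) t∉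

    rank-mono : ∀ {s t} → s ∈ F → t ∈ F → s ≼ t → rank s ≤ rank t
    rank-mono {s} {t} s∈F t∈F s≤t with em {P = s ≡ t}
    ... | yes refl = ℕ.≤-refl
    ... | no  s≢t with em {P = s ∈ times} | em {P = t ∈ times}
    ...   | no  s∉ | _      = z≤n
    ...   | yes _  | no  t∉ = contradiction (∈-resp-↭ (↭-sym (sort-↭ F)) t∈F) t∉
    ...   | yes s∈ | yes t∈ with ℕ.≤-total (toℕ (index s∈)) (toℕ (index t∈))
    ...     | inj₁ le = le
    ...     | inj₂ ge = contradiction (≼.antisym s≤t t≤s) s≢t
      where
      t≤s : t ≼ s
      t≤s = subst₂ _≼_ (sym (lookup-index t∈)) (sym (lookup-index s∈))
              (lookup-mono-≤ totalOrder (sort-↗ F) ge)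

    alive-bounded : ∀ {n v} → Alive n v → n < length times
    alive-bounded (i , refl , _) = toℕ<n i

    finite-layering : Layering em G R _≤_ Alive k
    finite-layering = layering em G R k Alive alive-convex (length times) alive-bounded alive-cover

    open Layering finite-layering public

  open Ultrafilter em ext Λ

  levelᶠ : Λ → V G → List Λ → ℕ
  levelᶠ t v F = Finite.level F (Finite.rank F t) v

  Sameᶠ : ℕ → Λ → Λ → List Λ → Set
  Sameᶠ l s t F = Finite.Same F l (Finite.rank F s) (Finite.rank F t)

  -- On the lists that contain `t` the level takes fewer than `k + 1` values, and the ultrafilter
  -- selects one of them.
  limit-level : ∀ {t v} → B t v → ∃[ l ] (l < k × Large (λ F → levelᶠ t v F ≡ l))
  limit-level {t} {v} Bt = large-value (levelᶠ t v) k
    (large-cone (t ∷ []) λ {F} F₀⊆F → Finite.level< F (Finite.alive-rank F (F₀⊆F (here refl)) Bt))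

  level-of : ∀ {t v} → Dec (B t v) → ℕ
  level-of (yes Bt) = proj₁ (limit-level Bt)
  level-of (no  _)  = 0

  level-of< : ∀ {t v} → B t v → (d : Dec (B t v)) → level-of d < k
  level-of< _  (yes Bt) = proj₁ (proj₂ (limit-level Bt))
  level-of< Bt (no ¬Bt) = contradiction Bt ¬Bt

  level-of-large : ∀ {t v} → B t v → (d : Dec (B t v)) → Large (λ F → levelᶠ t v F ≡ level-of d)
  level-of-large _  (yes Bt) = proj₂ (proj₂ (limit-level Bt))
  level-of-large Bt (no ¬Bt) = contradiction Bt ¬Bt

  -- Laws that conclude `Same` are transferred along a large set of lists. Conclusions about levels
  -- or distances need a single list that contains the times involved and shows the limiting levels.
  limit-layering : Layering em G R _≼_ B k
  limit-layering = record
    { level          = λ t v → level-of {t} {v} em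
    ; Same           = λ l s t → Large (Sameᶠ l s t)
    ; level<         = λ Bt → level-of< Bt em
    ; level-antitone = antitone
    ; same-refl      = large-cone [] λ {F} _ → Finite.same-refl F
    ; same-sym       = λ same → transfer [] same λ {F} _ → Finite.same-sym F
    ; same-trans     = λ same same′ → transfer [] (large-∩ same same′) λ {F} _ (e , e′) → Finite.same-trans F e e′
    ; same-convex    = convex
    ; two-periods    = two
    ; same-near      = near
    }
    where
    antitone : ∀ {s t v} → s ≼ t → B s v → B t v → level-of {t} {v} em ≤ level-of {s} {v} em
    antitone {s} {t} s≤t Bs Bt with witness (large-∩ (level-of-large Bs em) (level-of-large Bt em)) (s ∷ t ∷ [])
    ... | F , F₀⊆F , es , et = subst₂ ℕ._≤_ et es
      (Finite.level-antitone F (Finite.rank-mono F s∈F t∈F s≤t) (Finite.alive-rank F s∈F Bs) (Finite.alive-rank F t∈F Bt))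
      where
      s∈F = F₀⊆F (here refl)
      t∈F = F₀⊆F (there (here refl))

    convex : ∀ {l s t u} → s ≼ t → t ≼ u → Large (Sameᶠ l s u) → Large (Sameᶠ l s t)
    convex {s = s} {t} {u} s≤t t≤u same = transfer (s ∷ t ∷ u ∷ []) same λ {F} F₀⊆F →
      Finite.same-convex F
        (Finite.rank-mono F (F₀⊆F (here refl)) (F₀⊆F (there (here refl))) s≤t)
        (Finite.rank-mono F (F₀⊆F (there (here refl))) (F₀⊆F (there (there (here refl)))) t≤u)

    two : ∀ {l s t u v} → s ≼ t → t ≼ u → B s v → B t v → B u v →
          level-of {s} {v} em ≡ l → level-of {t} {v} em ≡ l → level-of {u} {v} em ≡ l →
          Large (Sameᶠ l s t) ⊎ Large (Sameᶠ l t u)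
    two {l} {s} {t} {u} s≤t t≤u Bs Bt Bu es et eu
      with dichotomy (Sameᶠ l s t) | dichotomy (Sameᶠ l t u)
    ... | inj₁ same | _         = inj₁ same
    ... | inj₂ _    | inj₁ same = inj₂ same
    ... | inj₂ ¬st  | inj₂ ¬tu
      with witness (large-∩ (large-∩ ¬st ¬tu) (large-∩ (level-of-large Bs em) (large-∩ (level-of-large Bt em) (level-of-large Bu em))))
                   (s ∷ t ∷ u ∷ [])
    ...   | F , F₀⊆F , (¬st′ , ¬tu′) , fs , ft , fu = [ (λ st → contradiction st ¬st′) , (λ tu → contradiction tu ¬tu′) ]′
      (Finite.two-periods F (Finite.rank-mono F s∈F t∈F s≤t) (Finite.rank-mono F t∈F u∈F t≤u)
        (Finite.alive-rank F s∈F Bs) (Finite.alive-rank F t∈F Bt) (Finite.alive-rank F u∈F Bu)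
        (trans fs es) (trans ft et) (trans fu eu))
      where
      s∈F = F₀⊆F (here refl)
      t∈F = F₀⊆F (there (here refl))
      u∈F = F₀⊆F (there (there (here refl)))

    near : ∀ {l s t u v} → B s u → B t v → level-of {s} {u} em ≡ l → level-of {t} {v} em ≡ l →
           Large (Sameᶠ l s t) → Near G (periodDiameter R) u v
    near {l} {s} {t} Bs Bt es et same
      with witness (large-∩ same (large-∩ (level-of-large Bs em) (level-of-large Bt em))) (s ∷ t ∷ [])
    ... | F , F₀⊆F , same′ , fs , ft =
      Finite.same-near F (Finite.alive-rank F s∈F Bs) (Finite.alive-rank F t∈F Bt) (trans fs es) (trans ft et) same′
      where
      s∈F = F₀⊆F (here refl)
      t∈F = F₀⊆F (there (here refl))

-- The quotient graph

-- The list is assembled value by value, since injectivity leaves at most one element for each value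
-- of `f`.
cardinality-≤ : (∀ {a} → ExcludedMiddle a) → {A : Set ℓ} (f : A → ℕ) (n : ℕ) (P : Pred A ℓ) →
                (∀ {x} → P x → f x < n) → (∀ {x y} → P x → P y → f x ≡ f y → x ≡ y) →
                ∃[ m ] (HasCardinality P m × m ≤ n)
cardinality-≤ em f zero    P f< inj =
  0 , ([] , [] , refl , λ _ → mk⇔ (λ Px → contradiction (f< Px) λ ()) λ ()) , z≤n
cardinality-≤ em f (suc n) P f< inj
  with cardinality-≤ em f n (λ x → P x × f x < n) proj₂ (λ (Px , _) (Py , _) → inj Px Py)
     | em {P = ∃[ x ] (P x × f x ≡ n)}
... | m , (xs , uniq , len , iff) , m≤n | no ∄x =
  m , (xs , uniq , len , λ v → mk⇔
    (λ Pv → Equivalence.to (iff v) (Pv , ℕ.≤∧≢⇒< (ℕ.s≤s⁻¹ (f< Pv)) λ fv≡n → ∄x (v , Pv , fv≡n)))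
    (λ v∈ → proj₁ (Equivalence.from (iff v) v∈))) , ℕ.m≤n⇒m≤1+n m≤n
... | m , (xs , uniq , len , iff) , m≤n | yes (x , Px , fx≡n) =
  suc m , (x ∷ xs , ¬Any⇒All¬ xs x∉xs ∷ uniq , cong suc len , λ v → mk⇔ to from) , s≤s m≤n
  where
  x∉xs : ¬ x ∈ xs
  x∉xs x∈xs = ℕ.<-irrefl fx≡n (proj₂ (Equivalence.from (iff x) x∈xs))

  to : ∀ {v} → P v → v ∈ x ∷ xs
  to {v} Pv with em {P = f v ≡ n}
  ... | yes fv≡n = here (inj Pv Px (trans fv≡n (sym fx≡n)))
  ... | no  fv≢n = there (Equivalence.to (iff v) (Pv , ℕ.≤∧≢⇒< (ℕ.s≤s⁻¹ (f< Pv)) fv≢n))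

  from : ∀ {v} → v ∈ x ∷ xs → P v
  from     (here refl) = Px
  from {v} (there v∈)  = proj₁ (Equivalence.from (iff v) v∈)

-- Three edges are the cost of `drop-level`; the power of two comes from the recursion in `spread`.
nodeSpread : ℕ → ℕ
nodeSpread g = 3 * 2 ^ g

-- One constant for everything: the first two summands pay for an edge of `G` in `H`, the last for
-- an edge of `H` in `G`, and the sum also exceeds the additive errors.
distortion : ℕ → ℕ → ℕ
distortion R k = nodeSpread k + (1 + nodeSpread k) + (periodDiameter R + 1)

module Quotient (em : ∀ {a} → ExcludedMiddle a) (ext : ∀ {a b} → Extensionality a b)
                (G : Graph ℓ) (R k : ℕ) (D : LineDecomposition G)
                (L : Layering em G R (LineDecomposition._≤_ D) (bag D) k) where
  open Comprehension em
  open LineDecomposition D using (isTotalOrder; interpolation; coversVertex; coversEdge)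
    renaming (bag to B; Point to Λ; _≤_ to _≼_)
  module ≼ = IsTotalOrder isTotalOrder
  module L = Layering L

  Δ = periodDiameter R
  σ = nodeSpread k
  K = distortion R k

  -- Irrelevance of the last field makes a node equal to any other with its level and class.
  record Node : Set ℓ where
    constructor node
    field
      level      : ℕ
      class      : Subset Λ
      .inhabited : ∃[ t ] ∃[ v ] (B t v × L.level t v ≡ level × class ≡ ⟦ L.Same level t ⟧)
  open Node

  nodeOf : ∀ {t v} → B t v → Node
  nodeOf {t} {v} Bt = node (L.level t v) ⟦ L.Same (L.level t v) t ⟧ (t , v , Bt , refl , refl)

  At : Node → Λ → V G → Set ℓ
  At N t v = B t v × L.level t v ≡ level N × t ∈ˢ class N

  at-nodeOf : ∀ {t v} (Bt : B t v) → At (nodeOf Bt) t v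
  at-nodeOf Bt = Bt , refl , ∈⁺ (L.Same _ _) L.same-refl

  class-of : ∀ N → ∃[ t ] ∃[ v ] (B t v × L.level t v ≡ level N × class N ≡ ⟦ L.Same (level N) t ⟧)
  class-of (node _ _ inhabited) = recompute em inhabited

  someone : ∀ N → ∃[ t ] ∃[ v ] At N t v
  someone N with class-of N
  ... | t , v , Bt , lev , class≡ = t , v , Bt , lev , subst (t ∈ˢ_) (sym class≡) (∈⁺ (L.Same _ _) L.same-refl)

  same-class : ∀ N {s t} → s ∈ˢ class N → t ∈ˢ class N → L.Same (level N) s t
  same-class N {s} {t} s∈ t∈ with class-of N
  ... | _ , _ , _ , _ , class≡ = L.same-trans
    (L.same-sym (∈⁻ (L.Same _ _) (subst (s ∈ˢ_) class≡ s∈))) (∈⁻ (L.Same _ _) (subst (t ∈ˢ_) class≡ t∈))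

  class-closed : ∀ N {s t} → s ∈ˢ class N → L.Same (level N) s t → t ∈ˢ class N
  class-closed N {s} {t} s∈ same with class-of N
  ... | _ , _ , _ , _ , class≡ = subst (t ∈ˢ_) (sym class≡)
    (∈⁺ (L.Same _ _) (L.same-trans (∈⁻ (L.Same _ _) (subst (s ∈ˢ_) class≡ s∈)) same))

  node-unique : ∀ {N N′ t} → level N ≡ level N′ → t ∈ˢ class N → t ∈ˢ class N′ → N ≡ N′
  node-unique {N@record{}} {N′@record{}} refl t∈ t∈′ = node-cong (⊆ˢ-antisym ext
      (λ s∈ → class-closed N′ t∈′ (same-class N t∈ s∈))
      (λ s∈ → class-closed N t∈ (same-class N′ t∈′ s∈)))
    where
    node-cong : class N ≡ class N′ → N ≡ N′
    node-cong refl = refl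

  at-unique : ∀ {N t v} (Bt : B t v) → At N t v → nodeOf Bt ≡ N
  at-unique Bt (_ , lev , t∈) = node-unique lev (proj₂ (proj₂ (at-nodeOf Bt))) t∈

  at-near : ∀ N {s t u v} → At N s u → At N t v → Near G Δ u v
  at-near N (Bs , eu , s∈) (Bt , ev , t∈) = L.same-near Bs Bt eu ev (same-class N s∈ t∈)

  -- The line of H consists of the cuts of Λ, each repeated once per level, so that several
  -- periods that change at the same cut do so one after another.

  record Cut : Set ℓ where
    constructor cut
    field
      members : Subset Λ
      .down   : ∀ {s t} → s ≼ t → t ∈ˢ members → s ∈ˢ members
  open Cut

  Position : Set ℓ
  Position = Cut × ℕ

  infix 4 _⊑_

  record _⊑_ (q q′ : Position) : Set ℓ where
    constructor ⟨_,_⟩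
    field
      contained : members (proj₁ q) ⊆ˢ members (proj₁ q′)
      ordered   : members (proj₁ q′) ⊆ˢ members (proj₁ q) → proj₂ q ≤ proj₂ q′
  open _⊑_

  ⊑-refl : ∀ {q} → q ⊑ q
  ⊑-refl = ⟨ (λ s∈ → s∈) , (λ _ → ℕ.≤-refl) ⟩

  ⊑-trans : ∀ {q q′ q″} → q ⊑ q′ → q′ ⊑ q″ → q ⊑ q″
  ⊑-trans ⟨ c⊆c′ , m≤m′ ⟩ ⟨ c′⊆c″ , m′≤m″ ⟩ =
    ⟨ (λ s∈ → c′⊆c″ (c⊆c′ s∈))
    , (λ c″⊆c → ℕ.≤-trans (m≤m′ λ s∈ → c″⊆c (c′⊆c″ s∈)) (m′≤m″ λ s∈ → c⊆c′ (c″⊆c s∈))) ⟩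

  ⊑-antisym : ∀ {q q′} → q ⊑ q′ → q′ ⊑ q → q ≡ q′
  ⊑-antisym {c , m} {c′ , m′} ⟨ c⊆c′ , m≤m′ ⟩ ⟨ c′⊆c , m′≤m ⟩ =
    cong₂ _,_ (cut-cong c c′ (⊆ˢ-antisym ext c⊆c′ c′⊆c)) (ℕ.≤-antisym (m≤m′ c′⊆c) (m′≤m c⊆c′))
    where
    cut-cong : ∀ c c′ → members c ≡ members c′ → c ≡ c′
    cut-cong (cut _ _) (cut _ _) refl = refl

  downward : ∀ c {s t} → s ≼ t → t ∈ˢ members c → s ∈ˢ members c
  downward (cut _ down) s≼t t∈ = recompute em (down s≼t t∈)

  ⊆-total : ∀ c c′ → members c ⊆ˢ members c′ ⊎ members c′ ⊆ˢ members c
  ⊆-total c c′ with em {P = ∃[ s ] (s ∈ˢ members c × ¬ s ∈ˢ members c′)}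
  ... | yes (s , s∈ , s∉) = inj₂ c′⊆c
    where
    c′⊆c : members c′ ⊆ˢ members c
    c′⊆c {t} t∈ with ≼.total t s
    ... | inj₁ t≼s = downward c t≼s s∈
    ... | inj₂ s≼t = contradiction (downward c′ s≼t t∈) s∉
  ... | no ∄s = inj₁ c⊆c′
    where
    c⊆c′ : members c ⊆ˢ members c′
    c⊆c′ {t} t∈ with em {P = t ∈ˢ members c′}
    ... | yes t∈′ = t∈′
    ... | no  t∉  = contradiction (t , t∈ , t∉) ∄s

  ⊑-total : ∀ q q′ → q ⊑ q′ ⊎ q′ ⊑ q
  ⊑-total (c , m) (c′ , m′) with em {P = members c ⊆ˢ members c′} | em {P = members c′ ⊆ˢ members c}
  ... | yes c⊆c′ | no  c′⊈c = inj₁ ⟨ c⊆c′ , (λ c′⊆c → contradiction (λ {s} → c′⊆c {s}) c′⊈c) ⟩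
  ... | no  c⊈c′ | yes c′⊆c = inj₂ ⟨ c′⊆c , (λ c⊆c′ → contradiction (λ {s} → c⊆c′ {s}) c⊈c′) ⟩
  ... | no  c⊈c′ | no  c′⊈c = [ (λ c⊆c′ → contradiction (λ {s} → c⊆c′ {s}) c⊈c′)
                              , (λ c′⊆c → contradiction (λ {s} → c′⊆c {s}) c′⊈c) ]′ (⊆-total c c′)
  ... | yes c⊆c′ | yes c′⊆c with ℕ.≤-total m m′
  ...   | inj₁ m≤m′ = inj₁ ⟨ c⊆c′ , (λ _ → m≤m′) ⟩
  ...   | inj₂ m′≤m = inj₂ ⟨ c′⊆c , (λ _ → m′≤m) ⟩

  positions : Line ℓ
  positions = record
    { Point        = Position
    ; _≤_          = _⊑_
    ; isTotalOrder = record
      { isPartialOrder = record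
        { isPreorder = record
          { isEquivalence = isEquivalence
          ; reflexive     = λ { refl → ⊑-refl }
          ; trans         = ⊑-trans
          }
        ; antisym = ⊑-antisym
        }
      ; total = ⊑-total
      }
    }

  -- Periods as intervals of positions

  Below : Node → Λ → Set ℓ
  Below N s = ∀ {t} → t ∈ˢ class N → ¬ t ≼ s

  Reached : Node → Λ → Set ℓ
  Reached N s = ∃[ t ] (t ∈ˢ class N × s ≼ t)

  -- The cuts before and after a class exist even if it has no first or last time. Both ends count
  -- as part of the interval, so consecutive periods of a level with no time between them share a
  -- position.
  start end : Node → Position
  start N = cut ⟦ Below N ⟧ (λ s≼t t∈ → ∈⁺ (Below N) λ u∈ u≼s → ∈⁻ (Below N) t∈ u∈ (≼.trans u≼s s≼t)) , level N
  end N = cut ⟦ Reached N ⟧ (λ s≼t t∈ → let (u , u∈ , t≼u) = ∈⁻ (Reached N) t∈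
                                         in ∈⁺ (Reached N) (u , u∈ , ≼.trans s≼t t≼u)) , level N

  start⊑end : ∀ {N N′ s t} → s ∈ˢ class N → t ∈ˢ class N′ → s ≼ t → start N ⊑ end N′
  start⊑end {N} {N′} {s} {t} s∈ t∈ s≼t = ⟨ sub , (λ end⊆start →
    contradiction ≼.refl (∈⁻ (Below N) (end⊆start (∈⁺ (Reached N′) (t , t∈ , s≼t))) s∈)) ⟩
    where
    sub : ⟦ Below N ⟧ ⊆ˢ ⟦ Reached N′ ⟧
    sub {u} u∈ with ≼.total s u
    ... | inj₁ s≼u = contradiction s≼u (∈⁻ (Below N) u∈ s∈)
    ... | inj₂ u≼s = ∈⁺ (Reached N′) (t , t∈ , ≼.trans u≼s s≼t)

  start⊑end-self : ∀ N → start N ⊑ end N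
  start⊑end-self N = let (_ , _ , _ , _ , t∈) = someone N in start⊑end {N} {N} t∈ t∈ ≼.refl

  -- A contact may be a single vertex, which passes from one period to the other. Contact alone
  -- would not put the two periods into a common bag, since it may occur at two distant times; hence
  -- the intervals are required to meet.
  record Adjacent (N N′ : Node) : Set ℓ where
    field
      distinct : N ≢ N′
      meets  : start N ⊑ end N′
      meets′ : start N′ ⊑ end N
      contact  : ∃[ s ] ∃[ u ] ∃[ t ] ∃[ v ] (At N s u × At N′ t v × Near G 1 u v)

  H : Graph ℓ
  H = record
    { V      = Node
    ; Adj    = Adjacent
    ; symm   = λ adj → let open Adjacent adj
                           (s , u , t , v , Nu , N′v , near) = contact
                       in record { distinct = ≢-sym distinct ; meets = meets′ ; meets′ = meets
                                 ; contact = t , v , s , u , N′v , Nu , near-sym G near }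
    ; irrefl = λ adj → Adjacent.distinct adj refl
    }

  bagᴴ : Position → Pred Node ℓ
  bagᴴ q N = start N ⊑ q × q ⊑ end N

  decomposition : LineDecomposition H
  decomposition = record
    { line          = positions
    ; bag           = bagᴴ
    ; coversVertex  = λ N → start N , ⊑-refl , start⊑end-self N
    ; coversEdge    = λ adj → covers adj
    ; interpolation = λ t≤t′ t′≤t″ (start≤t , _) (_ , t″≤end) → ⊑-trans start≤t t≤t′ , ⊑-trans t′≤t″ t″≤end
    }
    where
    covers : ∀ {N N′} → Adjacent N N′ → ∃[ q ] (bagᴴ q N × bagᴴ q N′)
    covers {N} {N′} adj with ⊑-total (start N) (start N′)
    ... | inj₁ le = start N′ , (le , Adjacent.meets′ adj) , (⊑-refl , start⊑end-self N′)
    ... | inj₂ ge = start N , (⊑-refl , start⊑end-self N) , (ge , Adjacent.meets adj)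

  end⊑start : ∀ {N N′ s t} → level N ≡ level N′ → N ≢ N′ → s ∈ˢ class N → t ∈ˢ class N′ → s ≼ t →
              end N ⊑ start N′
  end⊑start {N} {N′} {s} {t} lev N≢N′ s∈ t∈ s≼t = ⟨ sub , (λ _ → ℕ.≤-reflexive lev) ⟩
    where
    apart : ∀ {u} → u ∈ˢ class N → ¬ u ∈ˢ class N′
    apart u∈ u∈′ = N≢N′ (node-unique {N} {N′} lev u∈ u∈′)

    sub : ⟦ Reached N ⟧ ⊆ˢ ⟦ Below N′ ⟧
    sub {u} u∈ with ∈⁻ (Reached N) u∈
    ... | w , w∈ , u≼w = ∈⁺ (Below N′) λ {x} x∈ x≼u → crossing x∈ (≼.trans x≼u u≼w)
      where
      crossing : ∀ {x} → x ∈ˢ class N′ → ¬ x ≼ w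
      crossing x∈ x≼w with ≼.total w t
      ... | inj₁ w≼t = apart w∈ (class-closed N′ x∈ (L.same-convex x≼w w≼t (same-class N′ x∈ t∈)))
      ... | inj₂ t≼w = apart (class-closed N s∈ (L.same-convex s≼t t≼w (same-class N s∈ w∈))) t∈

  -- By `end⊑start` the two intervals overlap at most in one endpoint, and the earlier interval is
  -- not a single position because `s` lies between its two cuts.
  second-starts : ∀ {q N N′ s t} → level N ≡ level N′ → N ≢ N′ → s ∈ˢ class N → t ∈ˢ class N′ → s ≼ t →
                  bagᴴ q N → bagᴴ q N′ → start N′ ≡ q × start N ≢ q
  second-starts {q} {N} {N′} lev N≢N′ s∈ t∈ s≼t (_ , q≤end) (start≤q , _) =
    start≡q , λ { refl → contradiction
      (∈⁻ (Below N) (contained (⊑-trans end≤start start≤q) (∈⁺ (Reached N) (_ , s∈ , ≼.refl))) s∈) (λ ¬s≼s → ¬s≼s ≼.refl) }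
    where
    end≤start : end N ⊑ start N′
    end≤start = end⊑start {N} {N′} lev N≢N′ s∈ t∈ s≼t

    start≡q : start N′ ≡ q
    start≡q = ⊑-antisym start≤q (⊑-trans q≤end end≤start)

  -- A period that starts at `q` has the level of `q`, and by `second-starts` only one period can do
  -- so. It takes the extra slot `k`, leaving its level free for the period that it replaces.
  slot-of : ∀ {q N} → Dec (start N ≡ q) → ℕ
  slot-of         (yes _) = k
  slot-of {N = N} (no  _) = level N

  slot : Position → Node → ℕ
  slot q N = slot-of {q} {N} em

  level<k : ∀ N → level N < k
  level<k N = let (_ , _ , Bt , lev , _) = someone N in subst (_< k) lev (L.level< Bt)

  slot< : ∀ q N → slot q N < suc k
  slot< q N with em {P = start N ≡ q}
  ... | yes _ = ℕ.n<1+n k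
  ... | no  _ = ℕ.m<n⇒m<1+n (level<k N)

  same-level-same-status : ∀ {q N N′} → bagᴴ q N → bagᴴ q N′ → level N ≡ level N′ →
                           (start N ≡ q × start N′ ≡ q) ⊎ (start N ≢ q × start N′ ≢ q) → N ≡ N′
  same-level-same-status {q} {N} {N′} bN bN′ lev status with em {P = N ≡ N′}
  ... | yes N≡N′ = N≡N′
  ... | no  N≢N′ with someone N | someone N′
  ...   | s , _ , _ , _ , s∈ | t , _ , _ , _ , t∈ with ≼.total s t
  ...     | inj₁ s≼t = let (start≡ , start≢) = second-starts {q} {N} {N′} lev N≢N′ s∈ t∈ s≼t bN bN′ in
    [ (λ (eq , _) → contradiction eq start≢) , (λ (_ , neq) → contradiction start≡ neq) ]′ status
  ...     | inj₂ t≼s = let (start≡ , start≢) = second-starts {q} {N′} {N} (sym lev) (≢-sym N≢N′) t∈ s∈ t≼s bN′ bN in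
    [ (λ (_ , eq) → contradiction eq start≢) , (λ (neq , _) → contradiction start≡ neq) ]′ status

  slot-injective : ∀ {q N N′} → bagᴴ q N → bagᴴ q N′ → slot q N ≡ slot q N′ → N ≡ N′
  slot-injective {q} {N} {N′} bN bN′ eq with em {P = start N ≡ q} | em {P = start N′ ≡ q}
  ... | yes s≡q | yes s′≡q = same-level-same-status bN bN′ (cong proj₂ (trans s≡q (sym s′≡q))) (inj₁ (s≡q , s′≡q))
  ... | no  s≢q | no  s′≢q = same-level-same-status bN bN′ eq (inj₂ (s≢q , s′≢q))
  ... | yes _   | no  _    = contradiction (level<k N′) (ℕ.<-irrefl (sym eq))
  ... | no  _   | yes _    = contradiction (level<k N) (ℕ.<-irrefl eq)

  width : WidthAtMost decomposition k
  width q = cardinality-≤ em (slot q) (suc k) (bagᴴ q) (λ {N} _ → slot< q N) slot-injective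

  -- Distances in `H` between the periods of one vertex

  touching : ∀ {N N′ s t u v} → At N s u → At N′ t v → Near G 1 u v → start N ⊑ end N′ → start N′ ⊑ end N →
             Near H 1 N N′
  touching {N} {N′} Nu N′v near le le′ with em {P = N ≡ N′}
  ... | yes refl = near-refl H
  ... | no  N≢N′ = near-adj H record
    { distinct = N≢N′ ; meets = le ; meets′ = le′ ; contact = _ , _ , _ , _ , Nu , N′v , near }

  simultaneous : ∀ {t u v} (Bu : B t u) (Bv : B t v) → Near G 1 u v → Near H 1 (nodeOf Bu) (nodeOf Bv)
  simultaneous Bu Bv near = touching (at-nodeOf Bu) (at-nodeOf Bv) near
    (start⊑end {nodeOf Bu} {nodeOf Bv} (here-class Bu) (here-class Bv) ≼.refl)
    (start⊑end {nodeOf Bv} {nodeOf Bu} (here-class Bv) (here-class Bu) ≼.refl)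
    where
    here-class : ∀ {t v} (Bt : B t v) → t ∈ˢ class (nodeOf Bt)
    here-class Bt = proj₂ (proj₂ (at-nodeOf Bt))

  -- By `split` there is no gap of time between the two periods, so the cut that starts the second
  -- is not after the cut that ends the first. If the cuts coincide, `drop` decides: lower levels
  -- change first at a cut, so a vertex whose level falls finds its new period started by the time
  -- the old one ends.
  handover : ∀ {s t v} (Bs : B s v) (Bt : B t v) → s ≼ t → L.level t v ≤ L.level s v →
             (∀ {x} → s ≼ x → x ≼ t → L.Same (L.level s v) s x ⊎ L.Same (L.level t v) x t) →
             Near H 1 (nodeOf Bs) (nodeOf Bt)
  handover {s} {t} {v} Bs Bt s≼t drop split =
    touching (at-nodeOf Bs) (at-nodeOf Bt) (near-refl G) (start⊑end {N} {N′} s∈ t∈ s≼t) ⟨ sub , (λ _ → drop) ⟩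
    where
    N  = nodeOf Bs
    N′ = nodeOf Bt
    s∈ = proj₂ (proj₂ (at-nodeOf Bs))
    t∈ = proj₂ (proj₂ (at-nodeOf Bt))

    sub : ⟦ Below N′ ⟧ ⊆ˢ ⟦ Reached N ⟧
    sub {x} x∈ with ≼.total x s | ≼.total x t
    ... | inj₁ x≼s | _        = ∈⁺ (Reached N) (s , s∈ , x≼s)
    ... | inj₂ _   | inj₂ t≼x = contradiction t≼x (∈⁻ (Below N′) x∈ t∈)
    ... | inj₂ s≼x | inj₁ x≼t with split s≼x x≼t
    ...   | inj₁ same = ∈⁺ (Reached N) (x , class-closed N s∈ same , ≼.refl)
    ...   | inj₂ same = contradiction ≼.refl (∈⁻ (Below N′) x∈ (class-closed N′ t∈ (L.same-sym same)))

  stay-in-level : ∀ {s t v} (Bs : B s v) (Bt : B t v) → s ≼ t → L.level s v ≡ L.level t v →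
                  Near H 1 (nodeOf Bs) (nodeOf Bt)
  stay-in-level {s} {t} {v} Bs Bt s≼t eq = handover Bs Bt s≼t (ℕ.≤-reflexive (sym eq)) split
    where
    split : ∀ {x} → s ≼ x → x ≼ t → L.Same (L.level s v) s x ⊎ L.Same (L.level t v) x t
    split {x} s≼x x≼t = subst (λ l → L.Same (L.level s v) s x ⊎ L.Same l x t) eq
      (L.two-periods s≼x x≼t Bs Bx Bt refl (ℕ.≤-antisym (L.level-antitone s≼x Bs Bx)
        (subst (_≤ L.level x v) (sym eq) (L.level-antitone x≼t Bx Bt))) (sym eq))
      where Bx = interpolation s≼x x≼t Bs Bt

  -- There may be no last time at the old level, so a time in the last period of that level is
  -- sought instead. If the period has changed by `s′`, then `two-periods` forbids a second change;
  -- if it never changes, `s` serves.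
  leave-level : ∀ {s t v} → B s v → B t v → s ≼ t →
                ∃[ s′ ] (s ≼ s′ × s′ ≼ t × L.level s v ≡ L.level s′ v ×
                  (∀ {x} → s′ ≼ x → x ≼ t → L.level x v ≡ L.level s v → L.Same (L.level s v) s′ x))
  leave-level {s} {t} {v} Bs Bt s≼t
    with em {P = ∃[ s′ ] (s ≼ s′ × s′ ≼ t × L.level s v ≡ L.level s′ v × ¬ L.Same (L.level s v) s s′)}
  ... | no ∄s′ = s , ≼.refl , s≼t , refl , same
    where
    same : ∀ {x} → s ≼ x → x ≼ t → L.level x v ≡ L.level s v → L.Same (L.level s v) s x
    same {x} s≼x x≼t lev with em {P = L.Same (L.level s v) s x}
    ... | yes same-sx = same-sx
    ... | no  ¬same   = contradiction (x , s≼x , x≼t , sym lev , ¬same) ∄s′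
  ... | yes (s′ , s≼s′ , s′≼t , lev′ , ¬same) = s′ , s≼s′ , s′≼t , lev′ , λ s′≼x x≼t lev →
    [ (λ same → contradiction same ¬same) , (λ same → same) ]′
      (L.two-periods s≼s′ s′≼x Bs (interpolation s≼s′ s′≼t Bs Bt)
        (interpolation (≼.trans s≼s′ s′≼x) x≼t Bs Bt) refl (sym lev′) lev)

  enter-level : ∀ {s t v} → B s v → B t v → s ≼ t →
                ∃[ t′ ] (s ≼ t′ × t′ ≼ t × L.level t′ v ≡ L.level t v ×
                  (∀ {x} → s ≼ x → x ≼ t′ → L.level x v ≡ L.level t v → L.Same (L.level t v) x t′))
  enter-level {s} {t} {v} Bs Bt s≼t
    with em {P = ∃[ t′ ] (s ≼ t′ × t′ ≼ t × L.level t′ v ≡ L.level t v × ¬ L.Same (L.level t v) t′ t)}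
  ... | no ∄t′ = t , s≼t , ≼.refl , refl , same
    where
    same : ∀ {x} → s ≼ x → x ≼ t → L.level x v ≡ L.level t v → L.Same (L.level t v) x t
    same {x} s≼x x≼t lev with em {P = L.Same (L.level t v) x t}
    ... | yes same-xt = same-xt
    ... | no  ¬same   = contradiction (x , s≼x , x≼t , lev , ¬same) ∄t′
  ... | yes (t′ , s≼t′ , t′≼t , lev′ , ¬same) = t′ , s≼t′ , t′≼t , lev′ , λ s≼x x≼t′ lev →
    [ (λ same → same) , (λ same → contradiction same ¬same) ]′
      (L.two-periods x≼t′ t′≼t (interpolation s≼x (≼.trans x≼t′ t′≼t) Bs Bt)
        (interpolation s≼t′ t′≼t Bs Bt) Bt lev lev′ refl)

  -- The three edges lead to the last period at the old level, across to the first period at the new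
  -- level, and on to the period of `t`.
  drop-level : ∀ {s t v} (Bs : B s v) (Bt : B t v) → s ≼ t →
               (∀ {x} → s ≼ x → x ≼ t → L.level x v ≡ L.level s v ⊎ L.level x v ≡ L.level t v) →
               Near H 3 (nodeOf Bs) (nodeOf Bt)
  drop-level {s} {t} {v} Bs Bt s≼t two-levels with leave-level Bs Bt s≼t
  ... | s′ , s≼s′ , s′≼t , lev-s′ , after with enter-level (interpolation s≼s′ s′≼t Bs Bt) Bt s′≼t
  ...   | t′ , s′≼t′ , t′≼t , lev-t′ , before =
    near-trans H (stay-in-level Bs Bs′ s≼s′ lev-s′)
      (near-trans H (handover Bs′ Bt′ s′≼t′ (L.level-antitone s′≼t′ Bs′ Bt′) split) (stay-in-level Bt′ Bt t′≼t lev-t′))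
    where
    Bs′ = interpolation s≼s′ s′≼t Bs Bt
    Bt′ = interpolation (≼.trans s≼s′ s′≼t′) t′≼t Bs Bt

    split : ∀ {x} → s′ ≼ x → x ≼ t′ → L.Same (L.level s′ v) s′ x ⊎ L.Same (L.level t′ v) x t′
    split {x} s′≼x x≼t′ with two-levels (≼.trans s≼s′ s′≼x) (≼.trans x≼t′ t′≼t)
    ... | inj₁ lev = inj₁ (subst (λ l → L.Same l s′ x) lev-s′ (after s′≼x (≼.trans x≼t′ t′≼t) lev))
    ... | inj₂ lev = inj₂ (subst (λ l → L.Same l x t′) (sym lev-t′) (before s′≼x x≼t′ lev))

  -- If the vertex passes a level strictly in between, recursing on both sides doubles the bound.
  spread : ∀ g {s t v} (Bs : B s v) (Bt : B t v) → s ≼ t → L.level s v ≤ L.level t v + g →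
           Near H (nodeSpread g) (nodeOf Bs) (nodeOf Bt)
  spread zero Bs Bt s≼t gap =
    near-weaken H (s≤s z≤n) (stay-in-level Bs Bt s≼t
      (ℕ.≤-antisym (ℕ.≤-trans gap (ℕ.≤-reflexive (ℕ.+-identityʳ _))) (L.level-antitone s≼t Bs Bt)))
  spread (suc g) {s} {t} {v} Bs Bt s≼t gap
    with em {P = ∃[ x ] (s ≼ x × x ≼ t × L.level t v < L.level x v × L.level x v < L.level s v)}
  ... | yes (x , s≼x , x≼t , above , below) =
    near-weaken H (ℕ.≤-reflexive doubled) (near-trans H (spread g Bs Bx s≼x head-gap) (spread g Bx Bt x≼t tail-gap))
    where
    Bx = interpolation s≼x x≼t Bs Bt

    doubled : nodeSpread g + nodeSpread g ≡ nodeSpread (suc g)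
    doubled = trans (sym (ℕ.*-distribˡ-+ 3 (2 ^ g) (2 ^ g)))
                    (cong (λ n → 3 * (2 ^ g + n)) (sym (ℕ.+-identityʳ (2 ^ g))))

    gap′ : L.level s v ≤ suc (L.level t v + g)
    gap′ = ℕ.≤-trans gap (ℕ.≤-reflexive (ℕ.+-suc (L.level t v) g))

    head-gap : L.level s v ≤ L.level x v + g
    head-gap = ℕ.≤-trans gap′ (ℕ.+-monoˡ-≤ g above)

    tail-gap : L.level x v ≤ L.level t v + g
    tail-gap = ℕ.s≤s⁻¹ (ℕ.≤-trans below gap′)
  ... | no ∄x = near-weaken H (ℕ.*-monoʳ-≤ 3 (ℕ.m^n>0 2 (suc g))) (drop-level Bs Bt s≼t two-levels)
    where
    two-levels : ∀ {x} → s ≼ x → x ≼ t → L.level x v ≡ L.level s v ⊎ L.level x v ≡ L.level t v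
    two-levels {x} s≼x x≼t with ℕ.m≤n⇒m<n∨m≡n (L.level-antitone s≼x Bs Bx) | ℕ.m≤n⇒m<n∨m≡n (L.level-antitone x≼t Bx Bt)
      where Bx = interpolation s≼x x≼t Bs Bt
    ... | inj₂ eq    | _          = inj₁ eq
    ... | inj₁ _     | inj₂ eq    = inj₂ (sym eq)
    ... | inj₁ below | inj₁ above = contradiction (x , s≼x , x≼t , above , below) ∄x

  same-vertex-near : ∀ {s t v} (Bs : B s v) (Bt : B t v) → Near H σ (nodeOf Bs) (nodeOf Bt)
  same-vertex-near {s} {t} Bs Bt with ≼.total s t
  -- The gap `k` suffices because all levels are below `k`.
  ... | inj₁ s≼t = spread k Bs Bt s≼t (ℕ.≤-trans (ℕ.<⇒≤ (L.level< Bs)) (ℕ.m≤n+m k _))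
  ... | inj₂ t≼s = near-sym H (spread k Bt Bs t≼s (ℕ.≤-trans (ℕ.<⇒≤ (L.level< Bt)) (ℕ.m≤n+m k _)))

  -- The quasi-isometry

  φ : V G → Node
  φ v = nodeOf (proj₂ (coversVertex v))

  -- The bags chosen by `φ` for the ends of an edge may differ from a bag containing the edge;
  -- changing bags costs `σ` at each end, and crossing the edge costs 1.
  φ-walk : ∀ {u v} (p : Walk G u v) → Near H (edges G p * (σ + (1 + σ))) (φ u) (φ v)
  φ-walk nil        = near-refl H
  φ-walk (cons e p) with coversEdge e
  ... | _ , Bu , Bv = near-trans H
    (near-trans H (same-vertex-near (proj₂ (coversVertex _)) Bu)
      (near-trans H (simultaneous Bu Bv (near-adj G e)) (same-vertex-near Bv (proj₂ (coversVertex _)))))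
    (φ-walk p)

  -- A walk with `n` edges traverses `n + 1` periods, each of diameter at most `Δ`, and `n` contacts
  -- of length at most 1.
  H-walk : ∀ {N N′} (p : Walk H N N′) → ∀ {s t u v} → At N s u → At N′ t v →
           Near G (edges H p * (Δ + 1) + Δ) u v
  H-walk {N} nil        Nu Nv = at-near N Nu Nv
  H-walk {N} (cons e p) Nu Nv =
    let (_ , _ , _ , _ , Nw , N′x , near) = Adjacent.contact e
    in near-weaken G (ℕ.≤-reflexive (sym (ℕ.+-assoc (Δ + 1) (edges H p * (Δ + 1)) Δ)))
         (near-trans G (near-trans G (at-near N Nu Nw) near) (H-walk p N′x Nv))

  within : ∀ {ℓ} (J : Graph ℓ) d {n x y} → n ≤ d * K + K → Near J n x y → DistAtMost J x y (fromℕ K ·ʳ d +ʳ fromℕ K)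
  within J d n≤ = near⇒DistAtMost em J (fromℕ K ·ʳ d +ʳ fromℕ K) λ q<n → fromℕ-affine d K K n≤ q<n

  quasi-isometry : IsQuasiIsometry (fromℕ K) (fromℕ K) G H φ
  quasi-isometry = record
    { upper = λ { u v d ((p , _ , refl) , _) → within H d
        (ℕ.≤-trans (ℕ.*-monoʳ-≤ d (ℕ.m≤m+n (σ + (1 + σ)) (Δ + 1))) (ℕ.m≤m+n (d * K) K)) (φ-walk p) }
    ; lower = λ { u v d ((p , _ , refl) , _) → within G d
        (ℕ.+-mono-≤ (ℕ.*-monoʳ-≤ d (ℕ.m≤n+m (Δ + 1) (σ + (1 + σ))))
          (ℕ.≤-trans (ℕ.m≤m+n Δ 1) (ℕ.m≤n+m (Δ + 1) (σ + (1 + σ)))))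
        (H-walk p (at-nodeOf (proj₂ (coversVertex u))) (at-nodeOf (proj₂ (coversVertex v)))) }
    ; dense = λ N → let (_ , v , Nv@(Bv , _)) = someone N in
        v , near⇒DistAtMost em H (fromℕ K) (λ q<n → fromℕ-mono (ℕ.≤-trans (ℕ.m≤m+n σ (1 + σ)) (ℕ.m≤m+n _ (Δ + 1))) q<n)
          (subst (Near H σ (φ v)) (at-unique Bv Nv) (same-vertex-near (proj₂ (coversVertex v)) Bv))
    }

union⇒cover : (em : ∀ {a} → ExcludedMiddle a) (G : Graph ℓ) {r : ℝ} {R k : ℕ} → (∀ {d} → fromℕ d ≤ʳ r → d ≤ R) →
              {X : Pred (V G) ℓ} → UnionOfAtMost G k r X → Cover em G R k X
union⇒cover em G r≤R (j , j≤k , Xs , iff , diam) =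
  (λ Xv → inject≤ (proj₁ (Equivalence.to (iff _) Xv)) j≤k) ,
  λ Xu Xv eq → near (Equivalence.to (iff _) Xu) (Equivalence.to (iff _) Xv) (inject≤-injective j≤k j≤k _ _ eq)
  where
  near : ∀ {u v} ((i , _) : ∃[ i ] Xs i u) ((i′ , _) : ∃[ i′ ] Xs i′ v) → i ≡ i′ → Near G _ u v
  near (i , Xu) (_ , Xv) refl with diam i Xu Xv
  ... | d , ((p , _ , refl) , _) , d≤r = p , r≤R d≤r

mainTheorem4 : (∀ {a} → ExcludedMiddle a) →
    (∀ {a b} → Extensionality a b) →
    ∀ {ℓ : Level} (k : ℕ) (r : ℝ) → fromℕ 0 ≤ʳ r →
    ∃ λ (L : ℝ) → ∃ λ (C : ℝ) → fromℕ 1 ≤ʳ L × fromℕ 1 ≤ʳ C ×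
    ((G : Graph ℓ) (D : LineDecomposition G) →
    (∀ t → UnionOfAtMost G k r (bag D t)) →
    ∃ λ (H : Graph ℓ) → LineWidthAtMost H k × AdmitsQuasiIsometry L C G H)
mainTheorem4 em ext k r _ with ℕ-bound r
... | R , r≤R = fromℕ K , fromℕ K , (λ {q} → 1≤K {q}) , (λ {q} → 1≤K {q}) , construct
  where
  K : ℕ
  K = distortion R k

  1≤K : fromℕ 1 ≤ʳ fromℕ K
  1≤K = fromℕ-mono (ℕ.≤-trans (ℕ.m≤n+m 1 (periodDiameter R)) (ℕ.m≤n+m _ (nodeSpread k + (1 + nodeSpread k))))

  construct : (G : Graph _) (D : LineDecomposition G) → (∀ t → UnionOfAtMost G k r (bag D t)) →
              ∃ λ (H : Graph _) → LineWidthAtMost H k × AdmitsQuasiIsometry (fromℕ K) (fromℕ K) G H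
  construct G D union = H , (decomposition , width) , φ , quasi-isometry
    where
    cover : ∀ t → Cover em G R k (bag D t)
    cover t = union⇒cover em G {r} (λ {d} → r≤R {d}) (union t)

    open Compactness em ext G R k D cover using (limit-layering)
    open Quotient em ext G R k D limit-layering
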